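{- Let $m\in\mathbb{N}$ and $N\in\mathbb{N}$ with $N\ge 2$. For $k\in\mathbb{N}$ let $\mathcal{N}_k(n)$ be the number of $k$-part sum systems generating $0,\dots,n-1$ (all components of cardinality at least $2$), and set $\mathcal{N}_0(n)=\delta_{n,1}$. Then \[ \mathcal{N}_m(N)=\sum_{d\mid N,\ d<N}\big((m-1)\mathcal{N}_m(d)+m\,\mathcal{N}_{m-1}(d)\big)=-m\sum_{d\mid N,\ d<N}\mu\!\left(\frac{N}{d}\right)\big(\mathcal{N}_m(d)+\mathcal{N}_{m-1}(d)\big). \] Moreover, with $\mathcal{M}_k(n)=\frac{1}{k!}\mathcal{N}_k(n)$ for $k\ge 0$, \[ \mathcal{M}_m(N)=\sum_{d\mid N,\ d<N}\big((m-1)\mathcal{M}_m(d)+\mathcal{M}_{m-1}(d)\big)=-\sum_{d\mid N,\ d<N}\mu\!\left(\frac{N}{d}\right)\big(m\,\mathcal{M}_m(d)+\mathcal{M}_{m-1}(d)\big). \]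
   Context: A $k$-part sum system generating $0,\dots,n-1$ is an ordered $k$-tuple of sets $A_1,\dots,A_k\subset\mathbb{N}_0$ with $|A_j|\ge2$, $|A_1|\cdots|A_k|=n$ and $A_1+\dots+A_k=\{0,1,\dots,n-1\}$ (Minkowski sum). Equivalently, $\mathcal{N}_k(n)=\sum_{L\ge0}k!\,S(L,k)\,(e-\mu)^{*L}(n)$ with $S(L,k)$ Stirling numbers of the second kind, $e(n)=\delta_{n,1}$, $\mu$ the Möbius function and $*$ Dirichlet convolution; this formula with $k=0$ gives the convention $\mathcal{N}_0(n)=\delta_{n,1}$. $\mathcal{M}_k(n)$ counts such systems up to permutation of the $k$ parts. -}

module Defs where

open import Data.Nat as ℕ using (ℕ; zero; suc; _≤_; _<_; _≤?_; _<?_; _!)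
open import Data.Nat.Properties using (_!≢0)
open import Data.Nat.Divisibility using (_∣_; _∣?_)
open import Data.Nat.DivMod using (_/_)
open import Data.Nat.Primality using (Prime; prime?)
open import Data.Integer as ℤ using (ℤ; +_)
open import Data.Rational as ℚ using (ℚ)
open import Data.List using (List; []; _∷_; map; concatMap; _++_; upTo; length; filter; foldr; applyUpTo)
open import Data.List.Relation.Unary.All using (All)
import Data.List.Relation.Unary.All as All
open import Data.List.Membership.DecPropositional ℕ._≟_ using (_∈_; _∈?_)
open import Data.Product using (_×_)
open import Relation.Binary.PropositionalEquality using (_≡_)
open import Relation.Nullary using (Dec; yes; no; ¬_)
open import Data.Nat.ListAction using (product)
open import Relation.Nullary.Decidable using (_×-dec_; ¬?)

-- Finite sets of naturals as duplicate-free lists.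

-- All sublists of a list (each sub-selection exactly once).  Applied to
-- upTo n = [0,…,n-1] this lists every subset of {0,…,n-1} exactly once.
sublists : List ℕ → List (List ℕ)
sublists []       = [] ∷ []
sublists (x ∷ xs) = map (x ∷_) (sublists xs) ++ sublists xs

tuples : {A : Set} → ℕ → List A → List (List A)
tuples zero    xs = [] ∷ []
tuples (suc k) xs = concatMap (λ a → map (a ∷_) (tuples k xs)) xs

minkowski : List (List ℕ) → List ℕ
minkowski []       = 0 ∷ []
minkowski (A ∷ As) = concatMap (λ a → map (a ℕ.+_) (minkowski As)) A

SumSystem : ℕ → List (List ℕ) → Set
SumSystem n As =
  All (λ A → 2 ≤ length A) As
  × product (map length As) ≡ n
  × All (_< n) (minkowski As)
  × All (_∈ minkowski As) (upTo n)

sumSystem? : ∀ n As → Dec (SumSystem n As)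
sumSystem? n As =
  All.all? (λ A → 2 ≤? length A) As
  ×-dec (product (map length As) ℕ.≟ n)
  ×-dec All.all? (_<? n) (minkowski As)
  ×-dec All.all? (_∈? minkowski As) (upTo n)

-- 𝒩 k n : number of k-part sum systems generating 0,…,n-1.
-- (Every component of such a system is a subset of {0,…,n-1}, so it
-- suffices to enumerate k-tuples of subsets of {0,…,n-1}.)
-- For k = 0 this gives 𝒩 0 n = δ_{n,1}.
𝒩 : ℕ → ℕ → ℕ
𝒩 k n = length (filter (sumSystem? n) (tuples k (sublists (upTo n))))

ℳ : ℕ → ℕ → ℚ
ℳ k n = ℚ._/_ (+ 𝒩 k n) (k !) {{k !≢0}}

-- Möbius function: μ(n) = 0 if n is divisible by the square of a prime,
-- otherwise (-1)^(number of distinct prime divisors of n).  (μ 0 = 0 by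
-- convention; it is never used.)

primeDivisors : ℕ → List ℕ
primeDivisors n = filter (λ p → prime? p ×-dec (p ∣? n)) (upTo (suc n))

squareFree? : ∀ n → Dec (All (λ p → ¬ (p ℕ.* p ∣ n)) (primeDivisors n))
squareFree? n = All.all? (λ p → ¬? ((p ℕ.* p) ∣? n)) (primeDivisors n)

μ : ℕ → ℤ
μ zero = + 0
μ n@(suc _) with squareFree? n
... | yes _ = (ℤ.- ℤ.1ℤ) ℤ.^ length (primeDivisors n)
... | no  _ = + 0

-- Division N/d (only used for divisors d ≥ 1).

_div_ : ℕ → ℕ → ℕ
n div zero  = 0
n div suc d = n / suc d

properDivisors : ℕ → List ℕ
properDivisors N = filter (_∣? N) (applyUpTo suc (N ℕ.∸ 1))

Σℤ[d∣_,d<] : ℕ → (ℕ → ℤ) → ℤ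
Σℤ[d∣ N ,d<] f = foldr (λ d s → f d ℤ.+ s) (+ 0) (properDivisors N)

Σℚ[d∣_,d<] : ℕ → (ℕ → ℚ) → ℚ
Σℚ[d∣ N ,d<] f = foldr (λ d s → f d ℚ.+ s) ℚ.0ℚ (properDivisors N)

{-# OPTIONS --safe #-}
module Submission where

-- In a sum system generating 0,…,N-1 with N ≥ 2, exactly one part A contains 1; by symmetry it may be
-- taken to be the first one, at the cost of a factor m.  Let [0,f) be the initial run of A.  By de Bruijn's
-- lemma A = [0,f) + f B and the other parts are f Bᵢ, and B, B₂,…,Bₘ tile {0,…,d-1} with d = N/f < N and
-- 1 ∉ B.  Conversely every such tiling can be expanded.  If B = {0}, then B₂,…,Bₘ is one of the 𝒩_{m-1}(d)
-- sum systems; otherwise B,B₂,…,Bₘ is one of the ((m-1)/m) 𝒩_m(d) sum systems whose first part avoids 1.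
-- The second formula is the Möbius inversion of the first, and the formulas for ℳ follow on division by m!.

-- A sum system is required only to have sumset {0,...,n-1} and part sizes with product n. Comparing
-- the two counts shows that every number below n has exactly one representation. This uniqueness
-- drives everything: two parts containing 1 would give 1 two representations, and in de Bruijn's
-- lemma A is played off against the single set C of all sums of the other parts.
--
-- The expansion is injective because it remembers f: from 0 ∈ B and 1 ∉ B it follows that f is the
-- least number missing from [0,f) + f B. Since 0 and 1 lie in A, f ≥ 2, so d is a proper divisor.
--
-- The symmetry between the parts is obtained by summing a permutation-invariant weight over all
-- tuples, where two neighbouring positions can be exchanged. It is used twice, for N and for each
-- d. The fraction (m-1)/m never appears: the number of tilings for d is kept multiplied by m, which
-- is the factor contributed by the position of the part containing 1.

open import Defs
open import Algebra.Bundles using (CommutativeRing; CommutativeSemiring)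
open import Data.Bool using (if_then_else_)
open import Data.Empty using (⊥)
open import Data.Nat as ℕ using (ℕ)
import Data.Nat.Properties as ℕ
open import Data.List
  using (List; []; _∷_; map; concatMap; _++_; length; filter; foldr; upTo; applyUpTo; [_])
open import Data.List.Membership.DecPropositional ℕ._≟_ using (_∈?_)
open import Data.List.Membership.Propositional using (_∈_; find; lose; _∉_)
open import Data.List.Membership.Propositional.Properties
open import Data.List.Membership.Propositional.Properties.WithK using (unique∧set⇒bag)
open import Data.List.Properties
  using (length-++-sucʳ; length-++; length-map; length-applyUpTo; map-∘; map-cong;
         length-upTo; map-injective; ∷-injective; map-id-local; ∷-injectiveʳ)
open import Data.List.Relation.Binary.BagAndSetEquality using (∼bag⇒↭)
open import Data.List.Relation.Binary.Permutation.Propositional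
  using (_↭_; prep; swap; ↭-refl; ↭-trans; ↭-sym; ↭⇒↭ₛ)
open import Data.List.Relation.Binary.Permutation.Propositional.Properties as ↭
  using (shift; All-resp-↭; ↭-length)
open import Data.List.Relation.Binary.Permutation.Setoid.Properties using (Unique-resp-↭)
open import Data.List.Relation.Unary.All as All using (All; []; _∷_)
import Data.List.Relation.Unary.All.Properties as All
open import Data.List.Relation.Unary.AllPairs as AllPairs using (AllPairs; []; _∷_)
import Data.List.Relation.Unary.AllPairs.Properties as AllPairs
open import Data.List.Relation.Unary.Any using (here; there)
open import Data.List.Relation.Unary.Unique.Propositional using (Unique)
import Data.List.Relation.Unary.Unique.Propositional.Properties as Unique
open import Data.Product using (∃; _×_; _,_; proj₁; proj₂; ∃₂)
open import Data.Product.Properties using (,-injective)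
open import Data.Sum using (inj₁; inj₂; _⊎_)
open import Function using (_∘_; mk⇔)
open import Level using (0ℓ)
open import Relation.Nullary using (¬_; Dec; yes; no; does; contradiction)
open import Relation.Nullary.Decidable using (¬?; does-⇔; _×-dec_)
open import Relation.Unary using (Pred; Decidable)

-- Duplicate-free lists, counting by bijection, finite sums

module Lists where

  open import Data.List.Relation.Binary.Permutation.Propositional using (refl; trans)
  open import Data.Nat using (suc; s≤s; _≤_)
  open import Relation.Binary.PropositionalEquality as ≡ using (_≡_; _≢_; subst)

  private
    variable
      A B C : Set
      x : A
      y : B
      z : C
      xs ys : List A

  ∈-concatMap⁺′ : (f : A → List B) → x ∈ xs → y ∈ f x → y ∈ concatMap f xs
  ∈-concatMap⁺′ f x∈xs y∈fx = ∈-concatMap⁺ f (lose x∈xs y∈fx)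

  ∈-concatMap⁻′ : (f : A → List B) (xs : List A) → y ∈ concatMap f xs → ∃ λ x → x ∈ xs × y ∈ f x
  ∈-concatMap⁻′ f xs y∈ = find (∈-concatMap⁻ f {xs} y∈)

  module _ (g : A → B → C) {ys : A → List B} where

    -- The same pattern serves tuples (`g = _∷_`), Minkowski sums (`g = _+_`) and divisors paired
    -- with tilings (`g = _,_`).
    ∈-dependentProduct⁺ : x ∈ xs → y ∈ ys x → g x y ∈ concatMap (λ x → map (g x) (ys x)) xs
    ∈-dependentProduct⁺ x∈ y∈ = ∈-concatMap⁺′ _ x∈ (∈-map⁺ (g _) y∈)

    ∈-dependentProduct⁻ : ∀ xs → z ∈ concatMap (λ x → map (g x) (ys x)) xs →
                          ∃ λ x → ∃ λ y → x ∈ xs × y ∈ ys x × z ≡ g x y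
    ∈-dependentProduct⁻ xs z∈ with x , x∈ , z∈′ ← ∈-concatMap⁻′ (λ x → map (g x) (ys x)) xs z∈
      with y , y∈ , eq ← ∈-map⁻ (g x) z∈′ = x , y , x∈ , y∈ , eq

    dependentProduct-unique : (∀ {x x′ y y′} → g x y ≡ g x′ y′ → x ≡ x′ × y ≡ y′) →
                              (∀ x → Unique (ys x)) → ∀ {xs} → Unique xs →
                              Unique (concatMap (λ x → map (g x) (ys x)) xs)
    dependentProduct-unique g-inj ys! [] = []
    dependentProduct-unique g-inj ys! {x ∷ xs} x∷xs!@(_ ∷ xs!) =
      Unique.++⁺ (Unique.map⁺ (proj₂ ∘ g-inj) (ys! x)) (dependentProduct-unique g-inj ys! xs!) disjoint
      where
      disjoint : ∀ {z} → ¬ (z ∈ map (g x) (ys x) × z ∈ concatMap (λ x → map (g x) (ys x)) xs)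
      disjoint (z∈₁ , z∈₂) with _ , _ , z≡₁ ← ∈-map⁻ (g x) z∈₁
        with x′ , _ , x′∈ , _ , z≡₂ ← ∈-dependentProduct⁻ xs z∈₂ =
        Unique.Unique[x∷xs]⇒x∉xs x∷xs! (subst (_∈ xs) (≡.sym (proj₁ (g-inj (≡.trans (≡.sym z≡₁) z≡₂)))) x′∈)

  map⁺-unique : (f : A → B) → (∀ {x y} → x ∈ xs → y ∈ xs → f x ≡ f y → x ≡ y) →
                Unique xs → Unique (map f xs)
  map⁺-unique f f-inj [] = []
  map⁺-unique {xs = x ∷ xs} f f-inj x∷xs!@(_ ∷ xs!) =
    All.tabulate fx≢ ∷ map⁺-unique f (λ p q → f-inj (there p) (there q)) xs!
    where
    fx≢ : ∀ {z} → z ∈ map f xs → f x ≢ z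
    fx≢ z∈ fx≡z with y , y∈ , z≡ ← ∈-map⁻ f z∈ =
      Unique.Unique[x∷xs]⇒x∉xs x∷xs!
        (subst (_∈ xs) (≡.sym (f-inj (here ≡.refl) (there y∈) (≡.trans fx≡z z≡))) y∈)

  -- A permutation preserves lengths and sums, so each bijection below reduces to two absences of
  -- repetition and two inclusions.
  unique∧set⇒↭ : Unique xs → Unique ys → (∀ {x} → x ∈ xs → x ∈ ys) → (∀ {x} → x ∈ ys → x ∈ xs) → xs ↭ ys
  unique∧set⇒↭ xs! ys! xs⊆ys ys⊆xs = ∼bag⇒↭ (unique∧set⇒bag xs! ys! (mk⇔ xs⊆ys ys⊆xs))

  -- Removing each member of `xs` from `ys` in turn leaves nothing over. It serves to show that
  -- `ys`, the list of all sums of a tiling, has no repetitions.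
  pigeonhole : Unique xs → (∀ {x} → x ∈ xs → x ∈ ys) → length ys ≤ length xs → xs ↭ ys
  pigeonhole {xs = []} {ys = []} _ _ _ = ↭-refl
  pigeonhole {xs = x ∷ xs} x∷xs!@(_ ∷ xs!) xs⊆ys |ys|≤|xs|
    with ys₁ , ys₂ , ≡.refl ← ∈-∃++ (xs⊆ys (here ≡.refl)) =
    ↭-trans (prep x (pigeonhole xs! xs⊆ |ys|≤)) (↭-sym (shift x ys₁ ys₂))
    where
    xs⊆ : ∀ {z} → z ∈ xs → z ∈ ys₁ ++ ys₂
    xs⊆ z∈ with ∈-++⁻ ys₁ (xs⊆ys (there z∈))
    ... | inj₁ z∈₁ = ∈-++⁺ˡ z∈₁
    ... | inj₂ (here ≡.refl) = contradiction z∈ (Unique.Unique[x∷xs]⇒x∉xs x∷xs!)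
    ... | inj₂ (there z∈₂) = ∈-++⁺ʳ ys₁ z∈₂
    |ys|≤ : length (ys₁ ++ ys₂) ≤ length xs
    |ys|≤ with s≤s le ← subst (_≤ suc (length xs)) (length-++-sucʳ ys₁ x ys₂) |ys|≤|xs| = le

  module Summation (R : CommutativeSemiring 0ℓ 0ℓ) where
    open CommutativeSemiring R renaming (refl to ≈-refl; trans to ≈-trans; sym to ≈-sym; Carrier to K)
    open import Algebra.Properties.CommutativeSemigroup +-commutativeSemigroup using (interchange)
    open import Relation.Binary.Reasoning.Setoid setoid

    -- This `foldr` agrees by computation with the divisor sums of the statement and, over ℕ with
    -- the summand 1, with `length`, so counts can be handled as sums.
    Σ[_] : List A → (A → K) → K
    Σ[ xs ] f = foldr (λ x s → f x + s) 0# xs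

    Σ-cong : ∀ (xs : List A) {f g : A → K} → (∀ {x} → x ∈ xs → f x ≈ g x) → Σ[ xs ] f ≈ Σ[ xs ] g
    Σ-cong [] eq = ≈-refl
    Σ-cong (x ∷ xs) eq = +-cong (eq (here ≡.refl)) (Σ-cong xs (eq ∘ there))

    Σ-zero : ∀ (xs : List A) → Σ[ xs ] (λ _ → 0#) ≈ 0#
    Σ-zero [] = ≈-refl
    Σ-zero (x ∷ xs) = ≈-trans (+-identityˡ _) (Σ-zero xs)

    Σ-+ : ∀ (xs : List A) (f g : A → K) → Σ[ xs ] (λ x → f x + g x) ≈ Σ[ xs ] f + Σ[ xs ] g
    Σ-+ [] f g = ≈-sym (+-identityˡ 0#)
    Σ-+ (x ∷ xs) f g = begin
      f x + g x + Σ[ xs ] (λ x → f x + g x) ≈⟨ +-congˡ (Σ-+ xs f g) ⟩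
      f x + g x + (Σ[ xs ] f + Σ[ xs ] g)   ≈⟨ interchange (f x) (g x) (Σ[ xs ] f) (Σ[ xs ] g) ⟩
      f x + Σ[ xs ] f + (g x + Σ[ xs ] g)   ∎

    Σ-*ˡ : ∀ (xs : List A) c (f : A → K) → Σ[ xs ] (λ x → c * f x) ≈ c * Σ[ xs ] f
    Σ-*ˡ [] c f = ≈-sym (zeroʳ c)
    Σ-*ˡ (x ∷ xs) c f = ≈-trans (+-congˡ (Σ-*ˡ xs c f)) (≈-sym (distribˡ c (f x) _))

    Σ-++ : ∀ (xs ys : List A) (f : A → K) → Σ[ xs ++ ys ] f ≈ Σ[ xs ] f + Σ[ ys ] f
    Σ-++ [] ys f = ≈-sym (+-identityˡ _)
    Σ-++ (x ∷ xs) ys f = ≈-trans (+-congˡ (Σ-++ xs ys f)) (≈-sym (+-assoc _ _ _))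

    Σ-map : ∀ (g : A → B) xs (f : B → K) → Σ[ map g xs ] f ≈ Σ[ xs ] (f ∘ g)
    Σ-map g [] f = ≈-refl
    Σ-map g (x ∷ xs) f = +-congˡ (Σ-map g xs f)

    Σ-concatMap : ∀ (g : A → List B) xs (f : B → K) →
                  Σ[ concatMap g xs ] f ≈ Σ[ xs ] (λ x → Σ[ g x ] f)
    Σ-concatMap g [] f = ≈-refl
    Σ-concatMap g (x ∷ xs) f =
      ≈-trans (Σ-++ (g x) (concatMap g xs) f) (+-congˡ (Σ-concatMap g xs f))

    Σ-swap : ∀ (xs : List A) (ys : List B) (f : A → B → K) →
             Σ[ xs ] (λ x → Σ[ ys ] (f x)) ≈ Σ[ ys ] (λ y → Σ[ xs ] (λ x → f x y))
    Σ-swap [] ys f = ≈-sym (Σ-zero ys)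
    Σ-swap (x ∷ xs) ys f = ≈-trans (+-congˡ (Σ-swap xs ys f)) (≈-sym (Σ-+ ys (f x) _))

    Σ-↭ : ∀ {xs ys : List A} (f : A → K) → xs ↭ ys → Σ[ xs ] f ≈ Σ[ ys ] f
    Σ-↭ f refl = ≈-refl
    Σ-↭ f (prep x p) = +-congˡ (Σ-↭ f p)
    Σ-↭ f (swap x y p) = begin
      f x + (f y + _) ≈⟨ +-assoc (f x) (f y) _ ⟨
      f x + f y + _   ≈⟨ +-cong (+-comm (f x) (f y)) (Σ-↭ f p) ⟩
      f y + f x + _   ≈⟨ +-assoc (f y) (f x) _ ⟩
      f y + (f x + _) ∎
    Σ-↭ f (trans p q) = ≈-trans (Σ-↭ f p) (Σ-↭ f q)

    -- Depends only on `does`, so decisions of equivalent propositions have equal indicators.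
    ⟦_⟧ : {P : Set} → Dec P → K
    ⟦ P? ⟧ = if does P? then 1# else 0#

    module _ {P : Pred A 0ℓ} (P? : Decidable P) where

      Σ-filter : ∀ xs (f : A → K) → Σ[ filter P? xs ] f ≈ Σ[ xs ] (λ x → ⟦ P? x ⟧ * f x)
      Σ-filter [] f = ≈-refl
      Σ-filter (x ∷ xs) f with P? x
      ... | yes _ = +-cong (≈-sym (*-identityˡ (f x))) (Σ-filter xs f)
      ... | no _ = ≈-trans (Σ-filter xs f) (≈-trans (≈-sym (+-identityˡ _)) (+-congʳ (≈-sym (zeroˡ (f x)))))

      Σ-partition : ∀ xs (f : A → K) → Σ[ xs ] f ≈ Σ[ filter P? xs ] f + Σ[ filter (¬? ∘ P?) xs ] f
      Σ-partition [] f = ≈-sym (+-identityˡ 0#)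
      Σ-partition (x ∷ xs) f with P? x
      ... | yes _ = ≈-trans (+-congˡ (Σ-partition xs f)) (≈-sym (+-assoc _ _ _))
      ... | no _ = begin
        f x + Σ[ xs ] f                      ≈⟨ +-congˡ (≈-trans (Σ-partition xs f) (+-comm s₁ s₂)) ⟩
        f x + (s₂ + s₁)                      ≈⟨ +-assoc (f x) s₂ s₁ ⟨
        f x + s₂ + s₁                        ≈⟨ +-comm (f x + s₂) s₁ ⟩
        s₁ + (f x + s₂)                      ∎
        where
        s₁ = Σ[ filter P? xs ] f
        s₂ = Σ[ filter (¬? ∘ P?) xs ] f

open Lists

-- De Bruijn's lemma for a direct sum of two sets

module DeBruijn where

  open import Data.Nat
  open import Data.Nat.DivMod
  open import Data.Nat.Divisibility
  open import Data.Nat.Induction using (<-rec)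
  open import Data.Nat.Properties
  open import Relation.Binary.PropositionalEquality using (_≡_; _≢_; refl; sym; trans; cong; subst; module ≡-Reasoning)

  -- Predicates rather than lists, because C will be the sumset of all remaining parts. Equality of
  -- the summands in A follows from `unique` by cancellation.
  record IsDirectSum (N : ℕ) (A C : ℕ → Set) : Set where
    field
      bounded : ∀ {a c} → A a → C c → a + c < N
      covers  : ∀ {x} → x < N → ∃₂ λ a c → A a × C c × x ≡ a + c
      unique  : ∀ {a c a′ c′} → A a → C c → A a′ → C c′ → a + c ≡ a′ + c′ → c ≡ c′

  -- `start` and `fill` together are the alternative between containment in A and disjointness from
  -- A. `fits` forbids a truncated last block and so yields that f divides N.
  record Block (N : ℕ) (A C : ℕ → Set) (f q : ℕ) : Set where
    field
      fits  : f + q * f ≤ N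
      start : ∀ {r} → r < f → A (r + q * f) → A (q * f)
      fill  : ∀ {r} → r < f → A (q * f) → A (r + q * f)
      gap   : ∀ {r} → r < f → C (r + q * f) → r ≡ 0

  -- De Bruijn's lemma: when [0,f) is the initial run of A, every block [qf, qf + f) below N is
  -- either contained in A or disjoint from A, and meets C at most in qf.
  module Blocks {N : ℕ} {A C : ℕ → Set} (A⊕C : IsDirectSum N A C)
                (f : ℕ) .{{f≢0 : NonZero f}} (0<N : 0 < N)
                (run : ∀ {r} → r < f → A r) (f∉A : ¬ A f) where
    open IsDirectSum A⊕C
    open Block

    0<f : 0 < f
    0<f = >-nonZero⁻¹ f

    pred<f : pred f < f
    pred<f = ≤-reflexive (suc-pred f)

    A0 : A 0
    A0 = run 0<f

    C0 : C 0
    C0 with a , c , _ , Cc , 0≡ ← covers 0<N = subst C (m+n≡0⇒n≡0 a (sym 0≡)) Cc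

    1+q*f≢0 : ∀ q → suc q * f ≢ 0
    1+q*f≢0 q eq = m<n⇒n≢0 0<f (m+n≡0⇒m≡0 f eq)

    -- Strong induction on q, by the block in which the summand c of q f = a + c lies. In block 0, c
    -- = 0 and q f ∈ A. In block t with 0 < t < q, c = t f and block q is a translate of a block of
    -- A. In block q itself, c = q f.
    block : ∀ q → q * f < N → Block N A C f q
    block = <-rec (λ q → q * f < N → Block N A C f q) step
      where
      step : ∀ q → (∀ {t} → t < q → t * f < N → Block N A C f t) → q * f < N → Block N A C f q
      step zero ih _ = record
        { fits  = subst (_≤ N) (trans (cong suc (+-identityʳ (pred f)))
                                      (trans (suc-pred f) (sym (+-identityʳ f)))) (bounded (run pred<f) C0)
        ; start = λ _ _ → A0
        ; fill  = λ {r} r<f _ → subst A (sym (+-identityʳ r)) (run r<f)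
        ; gap   = λ {r} r<f Cr → trans (sym (+-identityʳ r)) (unique A0 Cr (run r<f) C0 refl)
        }
      step q@(suc q-1) ih qf<N = by-summand (covers qf<N)
        where
        qf≢0 : q * f ≢ 0
        qf≢0 = 1+q*f≢0 q-1

        tf<N : ∀ {t} → t < q → t * f < N
        tf<N t<q = ≤-<-trans (*-monoˡ-≤ f (<⇒≤ t<q)) qf<N

        multiple : ∀ {c} → C c → c / f < q → c ≡ c / f * f
        multiple {c} Cc t<q = trans (m≡m%n+[m/n]*n c f) (cong (_+ c / f * f)
          (gap (ih t<q (tf<N t<q)) (m%n<n c f) (subst C (m≡m%n+[m/n]*n c f) Cc)))

        fits-from : ∀ {a c} → A a → C c → a + c ≡ pred f + q * f → f + q * f ≤ N
        fits-from Aa Cc eq = subst (λ g → g + q * f ≤ N) (suc-pred f) (subst (_< N) eq (bounded Aa Cc))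

        -- Here [0,f) + q f already represents the whole block, so a member of A (plus 0) or a
        -- member of C other than q f (plus 0) would be a second representation.
        at-multiple : ∀ {c} → C c → c ≡ q * f → Block N A C f q
        at-multiple Cc refl = record
          { fits  = fits-from (run pred<f) Cc refl
          ; start = λ r<f Ar → contradiction Ar (∉A r<f)
          ; fill  = λ r<f Aq → contradiction Aq (∉A 0<f)
          ; gap   = λ {r} r<f Cr → +-cancelʳ-≡ (q * f) r 0 (unique A0 Cr (run r<f) Cc refl)
          }
          where
          ∉A : ∀ {r} → r < f → ¬ A (r + q * f)
          ∉A r<f Ar = qf≢0 (sym (unique Ar C0 (run r<f) Cc (+-identityʳ _)))

        -- Block s = q - (t+1) lies in A by induction, and its translate by (t+1) f represents all
        -- of block q, leaving no room there for A or C.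
        shifted : ∀ {a t} → A a → C (suc t * f) → suc t < q → q * f ≡ a + suc t * f → Block N A C f q
        shifted {a} {t} Aa Cc 1+t<q eq = record
          { fits  = fits-from (filled pred<f) Cc (sum (pred f))
          ; start = λ r<f Ar → contradiction Ar (∉A r<f)
          ; fill  = λ r<f Aq → contradiction Aq (∉A 0<f)
          ; gap   = λ {r} r<f Cr → contradiction (unique A0 Cr (filled r<f) Cc (sym (sum r)))
                      (λ e → <⇒≱ (*-monoˡ-< f 1+t<q) (≤-trans (m≤n+m (q * f) r) (≤-reflexive e)))
          }
          where
          s = q ∸ suc t
          s<q : s < q
          s<q = ∸-monoʳ-< {q} z<s (<⇒≤ 1+t<q)
          s+1+t : s + suc t ≡ q
          s+1+t = m∸n+n≡m (<⇒≤ 1+t<q)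
          qf≡ : q * f ≡ s * f + suc t * f
          qf≡ = trans (cong (_* f) (sym s+1+t)) (*-distribʳ-+ f s (suc t))
          a≡ : a ≡ s * f
          a≡ = +-cancelʳ-≡ (suc t * f) a (s * f) (trans (sym eq) qf≡)
          filled : ∀ {r} → r < f → A (r + s * f)
          filled r<f = fill (ih s<q (tf<N s<q)) r<f (subst A a≡ Aa)
          sum : ∀ r → r + s * f + suc t * f ≡ r + q * f
          sum r = trans (+-assoc r _ _) (cong (r +_) (sym qf≡))
          ∉A : ∀ {r} → r < f → ¬ A (r + q * f)
          ∉A {r} r<f Ar = 1+q*f≢0 t
            (sym (unique Ar C0 (filled r<f) Cc (trans (+-identityʳ _) (sym (sum r)))))

        f≤qf : f ≤ q * f
        f≤qf = m≤m+n f (q-1 * f)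

        -- In f = a + c a summand c < f would be 0 by the lemma for block 0, which puts f in A. So c
        -- = f.
        Cf : C f
        Cf with a , c , Aa , Cc , f≡ ← covers (≤-<-trans f≤qf qf<N)
          with m≤n⇒m<n∨m≡n (≤-trans (m≤n+m c a) (≤-reflexive (sym f≡)))
        ... | inj₂ refl = Cc
        ... | inj₁ c<f with refl ← gap (ih z<s 0<N) c<f (subst C (sym (+-identityʳ c)) Cc) =
          contradiction (subst A (trans (sym (+-identityʳ a)) (sym f≡)) Aa) f∉A

        in-A : A (q * f) → Block N A C f q
        in-A Aq = record { fits = fits′ ; start = λ _ _ → Aq ; fill = fill′ ; gap = gap′ }
          where
          -- q f + f is a sum of a member of A and one of C, hence below N.
          fits′ : f + q * f ≤ N
          fits′ = <⇒≤ (subst (_< N) (+-comm (q * f) f) (bounded Aq Cf))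

          gap′ : ∀ {r} → r < f → C (r + q * f) → r ≡ 0
          gap′ {zero} _ _ = refl
          -- The witness f - r lies in the initial run of A, and (f - r) + (r + q f) and q f + f
          -- would represent the same number.
          gap′ {r@(suc _)} r<f Cr = contradiction (unique (run (∸-monoʳ-< {f} z<s (<⇒≤ r<f))) Cr Aq Cf
            (begin
              f ∸ r + (r + q * f) ≡⟨ +-assoc (f ∸ r) r (q * f) ⟨
              f ∸ r + r + q * f   ≡⟨ cong (_+ q * f) (m∸n+n≡m (<⇒≤ r<f)) ⟩
              f + q * f           ≡⟨ +-comm f (q * f) ⟩
              q * f + f           ∎))
            (λ e → <⇒≢ (≤-<-trans f≤qf (m<n+m (q * f) {r} z<s)) (sym e))
            where open ≡-Reasoning

          -- Write r + q f = a + c and locate c. Block 0 forces c = 0, as wanted. In the other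
          -- blocks c is a positive multiple of f, and q f gets a second representation besides q f
          -- + 0.
          fill′ : ∀ {r} → r < f → A (q * f) → A (r + q * f)
          fill′ {r} r<f _ with covers (<-≤-trans (+-monoˡ-< (q * f) r<f) fits′)
          ... | a , c , Aa , Cc , eq = by-block (c / f) refl
            where
            c≤ : c ≤ r + q * f
            c≤ = ≤-trans (m≤n+m c a) (≤-reflexive (sym eq))
            in-block : ∀ s → s < q → c ≡ s * f → A (r + q * f)
            in-block zero _ refl = subst A (trans (sym (+-identityʳ a)) (sym eq)) Aa
            -- Here a = r + u f ∈ A, so u f ∈ A by `start`, and q f = u f + (s+1) f competes with q
            -- f + 0.
            in-block (suc s) 1+s<q refl = contradiction
              (unique (start (ih u<q (tf<N u<q)) r<f (subst A a≡ Aa)) Cc Aq C0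
                (trans (sym qf≡) (sym (+-identityʳ _)))) (1+q*f≢0 s)
              where
              u = q ∸ suc s
              u<q : u < q
              u<q = ∸-monoʳ-< {q} z<s (<⇒≤ 1+s<q)
              qf≡ : q * f ≡ u * f + suc s * f
              qf≡ = trans (cong (_* f) (sym (m∸n+n≡m (<⇒≤ 1+s<q)))) (*-distribʳ-+ f u (suc s))
              a≡ : a ≡ r + u * f
              a≡ = +-cancelʳ-≡ (suc s * f) a _
                (trans (sym eq) (trans (cong (r +_) qf≡) (sym (+-assoc r _ _))))
            by-block : ∀ s → c / f ≡ s → A (r + q * f)
            by-block s refl with s ≤? q-1
            ... | yes s≤ = in-block s (s≤s s≤) (multiple Cc (s≤s s≤))
            ... | no s≰ = contradiction (unique A0 (subst C c≡qf Cc) Aq C0 (sym (+-identityʳ _))) qf≢0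
              where
              s≡q : c / f ≡ q
              s≡q = ≤-antisym (≤-pred (m<n*o⇒m/o<n {c} {suc q} (≤-<-trans c≤ (+-monoˡ-< (q * f) r<f)))) (≰⇒> s≰)
              c≡ : c ≡ c % f + q * f
              c≡ = trans (m≡m%n+[m/n]*n c f) (cong (λ s → c % f + s * f) s≡q)
              c≡qf : c ≡ q * f
              c≡qf = trans c≡ (cong (_+ q * f) (gap′ (m%n<n c f) (subst C c≡ Cc)))

        by-summand : (∃₂ λ a c → A a × C c × q * f ≡ a + c) → Block N A C f q
        by-summand (a , c , Aa , Cc , eq) with c / f ≤? q-1
        ... | yes t≤ = by-block (c / f) (s≤s t≤) (multiple Cc (s≤s t≤))
          where
          by-block : ∀ t → t < q → c ≡ t * f → Block N A C f q
          by-block zero _ refl = in-A (subst A (trans (sym (+-identityʳ a)) (sym eq)) Aa)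
          by-block (suc t) 1+t<q refl = shifted Aa Cc 1+t<q eq
        ... | no t≰ = at-multiple Cc (≤-antisym
            (≤-trans (m≤n+m c a) (≤-reflexive (sym eq)))
            (≤-trans (*-monoˡ-≤ f (≰⇒> t≰)) (m/n*n≤m c f)))

    -- If N / f * f were below N, the block starting there would have to fit below N, but it extends
    -- beyond N.
    N≡N∕f*f : N ≡ N / f * f
    N≡N∕f*f with m≤n⇒m<n∨m≡n (m/n*n≤m N f)
    ... | inj₂ eq = sym eq
    ... | inj₁ lt = contradiction (fits (block (N / f) lt)) (<⇒≱ (begin-strict
        N                   ≡⟨ m≡m%n+[m/n]*n N f ⟩
        N % f + N / f * f   <⟨ +-monoˡ-< (N / f * f) (m%n<n N f) ⟩
        f + N / f * f       ∎))
      where open ≤-Reasoning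

    below : ∀ x → x < N → x / f * f < N
    below x x<N = ≤-<-trans (m/n*n≤m x f) x<N

    C-multiple : ∀ {c} → C c → c ≡ c / f * f
    C-multiple {c} Cc = trans (m≡m%n+[m/n]*n c f) (cong (_+ c / f * f)
      (gap (block (c / f) (below c (bounded A0 Cc))) (m%n<n c f) (subst C (m≡m%n+[m/n]*n c f) Cc)))

    A-start : ∀ {a} → A a → A (a / f * f)
    A-start {a} Aa = start (block (a / f) (below a (subst (_< N) (+-identityʳ a) (bounded Aa C0))))
      (m%n<n a f) (subst A (m≡m%n+[m/n]*n a f) Aa)

    A-fill : ∀ b {r} → r < f → A (b * f) → A (r + b * f)
    A-fill b r<f Ab = fill (block b (subst (_< N) (+-identityʳ (b * f)) (bounded Ab C0))) r<f Ab

open DeBruijn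

-- Sorted sets, Minkowski sums, tilings and their expansion by a factor

module Tilings where

  open import Algebra.Properties.CommutativeSemigroup ℕ.+-commutativeSemigroup using (x∙yz≈y∙xz)
  open import Data.Nat
  open import Data.List.Relation.Binary.Permutation.Propositional using (refl; trans)
  open import Data.Nat.DivMod using (m≡m%n+[m/n]*n; m%n<n; m<n*o⇒m/o<n)
  open import Data.Nat.ListAction using (product)
  open import Data.Nat.ListAction.Properties using (product-↭)
  open import Data.Nat.Properties
  open import Relation.Binary.PropositionalEquality as ≡ using (_≡_; cong; cong₂; subst; sym; module ≡-Reasoning)

  private
    variable
      X : Set
      x y n d f a c : ℕ
      xs ys A B : List ℕ
      As Bs : List (List ℕ)

  -- The canonical form of a finite set: the sublists of `upTo n` are the strictly increasing ones,
  -- and for these equality of sets is equality of lists.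
  Sorted : List ℕ → Set
  Sorted = AllPairs _<_

  sorted-head≤ : Sorted (x ∷ xs) → y ∈ x ∷ xs → x ≤ y
  sorted-head≤ _ (here ≡.refl) = ≤-refl
  sorted-head≤ (x< ∷ _) (there y∈) = <⇒≤ (All.lookup x< y∈)

  sorted-ext : Sorted xs → Sorted ys → (∀ {x} → x ∈ xs → x ∈ ys) → (∀ {x} → x ∈ ys → x ∈ xs) → xs ≡ ys
  sorted-ext [] [] _ _ = ≡.refl
  sorted-ext [] (_ ∷ _) _ ⊇ with () ← ⊇ (here ≡.refl)
  sorted-ext (_ ∷ _) [] ⊆ _ with () ← ⊆ (here ≡.refl)
  sorted-ext {x ∷ xs} {y ∷ ys} xs<@(x< ∷ xs<′) ys<@(y< ∷ ys<′) ⊆ ⊇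
    with ≡.refl ← ≤-antisym (sorted-head≤ xs< (⊇ (here ≡.refl))) (sorted-head≤ ys< (⊆ (here ≡.refl)))
    = cong (x ∷_) (sorted-ext xs<′ ys<′ (tail x< ⊆) (tail y< ⊇))
    where
    tail : ∀ {xs ys} → All (x <_) xs → (∀ {z} → z ∈ x ∷ xs → z ∈ x ∷ ys) → ∀ {z} → z ∈ xs → z ∈ ys
    tail x< ⊆ z∈ with ⊆ (there z∈)
    ... | here ≡.refl = contradiction ≡.refl (<⇒≢ (All.lookup x< z∈))
    ... | there z∈ys = z∈ys

  upTo-sorted : ∀ n → Sorted (upTo n)
  upTo-sorted n = AllPairs.applyUpTo⁺₁ _ n (λ i<j _ → i<j)

  expand : ℕ → List ℕ → List ℕ
  expand f = concatMap (λ b → applyUpTo (_+ b * f) f)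

  scale : ℕ → List ℕ → List ℕ
  scale f = map (_* f)

  ∈-expand⁺ : ∀ {b r} → b ∈ B → r < f → r + b * f ∈ expand f B
  ∈-expand⁺ b∈ r<f = ∈-concatMap⁺′ _ b∈ (∈-applyUpTo⁺ _ r<f)

  ∈-expand⁻ : ∀ B → x ∈ expand f B → ∃₂ λ b r → b ∈ B × r < f × x ≡ r + b * f
  ∈-expand⁻ {f = f} B x∈ with b , b∈ , x∈′ ← ∈-concatMap⁻′ (λ b → applyUpTo (_+ b * f) f) B x∈
    with r , r<f , x≡ ← ∈-applyUpTo⁻ (_+ b * f) x∈′ = b , r , b∈ , r<f , x≡

  remainder-unique : ∀ b c {r s} → r < f → s < f → r + b * f ≡ s + c * f → r ≡ s × b ≡ c
  remainder-unique zero zero _ _ eq = +-cancelʳ-≡ 0 _ _ eq , ≡.refl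
  remainder-unique {f} zero (suc c) {r} {s} r<f _ eq = contradiction r<f (≤⇒≯ (begin
    f               ≤⟨ m≤m+n f (c * f) ⟩
    f + c * f       ≤⟨ m≤n+m _ s ⟩
    s + (f + c * f) ≡⟨ eq ⟨
    r + 0           ≡⟨ +-identityʳ r ⟩
    r               ∎))
    where open ≤-Reasoning
  remainder-unique (suc b) zero r<f s<f eq
    with s≡r , 0≡ ← remainder-unique zero (suc b) s<f r<f (sym eq) = sym s≡r , sym 0≡
  remainder-unique {f} (suc b) (suc c) {r} {s} r<f s<f eq
    with r≡s , b≡c ← remainder-unique b c r<f s<f (+-cancelˡ-≡ f _ _
      (≡.trans (x∙yz≈y∙xz f r (b * f)) (≡.trans eq (sym (x∙yz≈y∙xz f s (c * f))))))
    = r≡s , cong suc b≡c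

  ∈-expand-block : ∀ {b r} → r < f → r + b * f ∈ expand f B → b ∈ B
  ∈-expand-block {B = B} {b} r<f x∈ with c , _ , c∈ , s<f , eq ← ∈-expand⁻ B x∈
    with _ , ≡.refl ← remainder-unique b c r<f s<f eq = c∈

  length-expand : ∀ f B → length (expand f B) ≡ length B * f
  length-expand f [] = ≡.refl
  length-expand f (b ∷ B) = ≡.trans (length-++ (applyUpTo (_+ b * f) f))
    (cong₂ _+_ (length-applyUpTo (_+ b * f) f) (length-expand f B))

  expand-sorted : ∀ f → Sorted B → Sorted (expand f B)
  expand-sorted f [] = []
  expand-sorted {b ∷ B} f (b< ∷ B<) = AllPairs.++⁺
    (AllPairs.applyUpTo⁺₁ _ f (λ i<j _ → +-monoˡ-< (b * f) i<j))
    (expand-sorted f B<)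
    (All.applyUpTo⁺₁ _ f (λ {r} r<f → All.tabulate λ x∈ → below r<f (∈-expand⁻ B x∈)))
    where
    below : ∀ {r x} → r < f → (∃₂ λ c s → c ∈ B × s < f × x ≡ s + c * f) → r + b * f < x
    below {r} r<f (c , s , c∈ , _ , ≡.refl) = begin-strict
      r + b * f <⟨ +-monoˡ-< (b * f) r<f ⟩
      f + b * f ≤⟨ *-monoˡ-≤ f (All.lookup b< c∈) ⟩
      c * f     ≤⟨ m≤n+m (c * f) s ⟩
      s + c * f ∎
      where open ≤-Reasoning

  expand-injective : 0 < f → Sorted A → Sorted B → expand f A ≡ expand f B → A ≡ B
  expand-injective {f} 0<f A< B< eq = sorted-ext A< B<
    (λ x∈ → ∈-expand-block 0<f (subst (_ ∈_) eq (∈-expand⁺ x∈ 0<f)))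
    (λ x∈ → ∈-expand-block 0<f (subst (_ ∈_) (sym eq) (∈-expand⁺ x∈ 0<f)))

  -- One quotient undoes both operations: `scale f` on sets of multiples of f and `expand f` on
  -- unions of full blocks. Searching below n suffices for X inside [0,n), since b ≤ b f.
  contract : ℕ → ℕ → List ℕ → List ℕ
  contract f n X = filter (λ b → b * f ∈? X) (upTo n)

  contract-sorted : ∀ f n X → Sorted (contract f n X)
  contract-sorted f n X = AllPairs.filter⁺ (λ b → b * f ∈? X) (upTo-sorted n)

  ∈-contract⁻ : ∀ f n X {x} → x ∈ contract f n X → x * f ∈ X
  ∈-contract⁻ f n X x∈ = proj₂ (∈-filter⁻ (λ b → b * f ∈? X) {xs = upTo n} x∈)

  ∈-contract⁺ : ∀ f .{{_ : NonZero f}} {n X} x → All (_< n) X → x * f ∈ X → x ∈ contract f n X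
  ∈-contract⁺ f {X = X} x X<n x*f∈ = ∈-filter⁺ (λ b → b * f ∈? X)
    (∈-upTo⁺ (≤-<-trans (m≤m*n x f) (All.lookup X<n x*f∈))) x*f∈

  -- A choice of one member from each part. Permuting or rescaling the parts acts directly on such
  -- choices, unlike on nested concatenations.
  data _∈Σ_ : ℕ → List (List ℕ) → Set where
    []  : 0 ∈Σ []
    _∷_ : a ∈ A → c ∈Σ As → (a + c) ∈Σ (A ∷ As)

  ∈Σ-resp-≡ : x ≡ y → x ∈Σ As → y ∈Σ As
  ∈Σ-resp-≡ ≡.refl x∈ = x∈

  ∈Σ⇒∈minkowski : x ∈Σ As → x ∈ minkowski As
  ∈Σ⇒∈minkowski [] = here ≡.refl
  ∈Σ⇒∈minkowski {As = A ∷ As} (a∈ ∷ c∈) = ∈-dependentProduct⁺ _+_ {λ _ → minkowski As} a∈ (∈Σ⇒∈minkowski c∈)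

  ∈minkowski⇒∈Σ : ∀ As → x ∈ minkowski As → x ∈Σ As
  ∈minkowski⇒∈Σ [] (here ≡.refl) = []
  ∈minkowski⇒∈Σ (A ∷ As) x∈
    with _ , _ , a∈ , c∈ , ≡.refl ← ∈-dependentProduct⁻ _+_ {λ _ → minkowski As} A x∈ = a∈ ∷ ∈minkowski⇒∈Σ As c∈

  ∈Σ-uncons : x ∈Σ (A ∷ As) → ∃₂ λ a c → a ∈ A × c ∈Σ As × x ≡ a + c
  ∈Σ-uncons (a∈ ∷ c∈) = _ , _ , a∈ , c∈ , ≡.refl

  ∈Σ-↭ : As ↭ Bs → x ∈Σ As → x ∈Σ Bs
  ∈Σ-↭ refl x∈ = x∈
  ∈Σ-↭ (prep A p) (a∈ ∷ c∈) = a∈ ∷ ∈Σ-↭ p c∈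
  ∈Σ-↭ (swap A B p) (_∷_ {a} a∈ (_∷_ {b} {c = c} b∈ c∈)) =
    ∈Σ-resp-≡ (x∙yz≈y∙xz b a c) (b∈ ∷ a∈ ∷ ∈Σ-↭ p c∈)
  ∈Σ-↭ (trans p q) x∈ = ∈Σ-↭ q (∈Σ-↭ p x∈)

  0∈Σ⁻ : 0 ∈Σ (A ∷ As) → 0 ∈ A × 0 ∈Σ As
  0∈Σ⁻ 0∈ with a , c , a∈ , c∈ , 0≡ ← ∈Σ-uncons 0∈ =
    subst (_∈ _) (m+n≡0⇒m≡0 a (sym 0≡)) a∈ , ∈Σ-resp-≡ (m+n≡0⇒n≡0 a (sym 0≡)) c∈

  part⊆Σ : 0 ∈Σ As → A ∈ As → x ∈ A → x ∈Σ As
  part⊆Σ 0∈ (here ≡.refl) x∈ = ∈Σ-resp-≡ (+-identityʳ _) (x∈ ∷ proj₂ (0∈Σ⁻ 0∈))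
  part⊆Σ 0∈ (there A∈) x∈ with 0∈B , 0∈As ← 0∈Σ⁻ 0∈ = 0∈B ∷ part⊆Σ 0∈As A∈ x∈

  length-minkowski : ∀ As → length (minkowski As) ≡ product (map length As)
  length-minkowski [] = ≡.refl
  length-minkowski (A ∷ As) = ≡.trans (go A) (cong (length A *_) (length-minkowski As))
    where
    go : ∀ A → length (minkowski (A ∷ As)) ≡ length A * length (minkowski As)
    go [] = ≡.refl
    go (a ∷ A) = ≡.trans (length-++ (map (a +_) (minkowski As)))
                         (cong₂ _+_ (length-map (a +_) (minkowski As)) (go A))

  -- A sum system without the lower bound on part sizes, so that {0} is allowed as a part.
  record Tiling (n : ℕ) (As : List (List ℕ)) : Set where
    field
      product≡ : product (map length As) ≡ n
      bounded  : x ∈Σ As → x < n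
      covers   : x < n → x ∈Σ As

  open Tiling

  sumSystem⇒tiling : SumSystem n As → All (λ A → 2 ≤ length A) As × Tiling n As
  sumSystem⇒tiling {n} {As} (2≤ , prod , bnd , cov) = 2≤ , record
    { product≡ = prod
    ; bounded  = All.lookup bnd ∘ ∈Σ⇒∈minkowski
    ; covers   = ∈minkowski⇒∈Σ As ∘ All.lookup cov ∘ ∈-upTo⁺
    }

  tiling⇒sumSystem : All (λ A → 2 ≤ length A) As → Tiling n As → SumSystem n As
  tiling⇒sumSystem {As} 2≤ t = 2≤ , product≡ t ,
    All.tabulate (bounded t ∘ ∈minkowski⇒∈Σ As) ,
    All.tabulate (∈Σ⇒∈minkowski ∘ covers t ∘ ∈-upTo⁻)

  sumSystem-↭ : As ↭ Bs → SumSystem n As → SumSystem n Bs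
  sumSystem-↭ p s with 2≤ , t ← sumSystem⇒tiling s = tiling⇒sumSystem (All-resp-↭ p 2≤) record
    { product≡ = ≡.trans (sym (product-↭ (↭.map⁺ length p))) (product≡ t)
    ; bounded  = bounded t ∘ ∈Σ-↭ (↭-sym p)
    ; covers   = ∈Σ-↭ p ∘ covers t
    }

  -- The length of `minkowski As` counts representations and equals n, while all n numbers of
  -- `upTo n` occur in it. So none occurs twice.
  minkowski-unique : Tiling n As → Unique (minkowski As)
  minkowski-unique {n} {As} t = Unique-resp-↭ (≡.setoid ℕ) (↭⇒↭ₛ (pigeonhole (Unique.upTo⁺ n)
    (∈Σ⇒∈minkowski ∘ covers t ∘ ∈-upTo⁻) (≤-reflexive (begin
      length (minkowski As)   ≡⟨ length-minkowski As ⟩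
      product (map length As) ≡⟨ product≡ t ⟩
      n                       ≡⟨ length-upTo n ⟨
      length (upTo n)         ∎)))) (Unique.upTo⁺ n)
    where open ≡-Reasoning

  ++-unique⁻ʳ : ∀ (xs : List X) {ys} → Unique (xs ++ ys) → Unique ys
  ++-unique⁻ʳ [] u = u
  ++-unique⁻ʳ (x ∷ xs) (_ ∷ u) = ++-unique⁻ʳ xs u

  ++-unique⁻ˡ : ∀ (xs : List X) {ys} → Unique (xs ++ ys) → Unique xs
  ++-unique⁻ˡ [] _ = []
  ++-unique⁻ˡ (x ∷ xs) (x∉ ∷ u) = All.++⁻ˡ xs x∉ ∷ ++-unique⁻ˡ xs u

  ++-unique⇒disjoint : ∀ (xs : List X) {ys z} → Unique (xs ++ ys) → z ∈ xs → ¬ z ∈ ys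
  ++-unique⇒disjoint (x ∷ xs) (x∉ ∷ _) (here ≡.refl) z∈ys = All.lookup (All.++⁻ʳ xs x∉) z∈ys ≡.refl
  ++-unique⇒disjoint (x ∷ xs) (_ ∷ u) (there z∈) z∈ys = ++-unique⇒disjoint xs u z∈ z∈ys

  minkowski-unique-tail : ∀ A As → a ∈ A → Unique (minkowski (A ∷ As)) → Unique (minkowski As)
  minkowski-unique-tail (a ∷ _) As _ u = Unique.map⁻ (++-unique⁻ˡ (map (a +_) (minkowski As)) u)

  -- The Minkowski list is a concatenation of translates, one for each entry of A. Equal sums from
  -- different entries would be a repetition across translates; within one translate, cancel.
  summand-unique : ∀ A As {a a′ c c′} → Unique (minkowski (A ∷ As)) →
                   a ∈ A → c ∈Σ As → a′ ∈ A → c′ ∈Σ As → a + c ≡ a′ + c′ → c ≡ c′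
  summand-unique (b ∷ A) As u (here ≡.refl) c∈ (here ≡.refl) c′∈ eq = +-cancelˡ-≡ b _ _ eq
  summand-unique (b ∷ A) As u (here ≡.refl) c∈ (there a′∈) c′∈ eq = contradiction
    (subst (_∈ minkowski (A ∷ As)) (sym eq) (∈Σ⇒∈minkowski (a′∈ ∷ c′∈)))
    (++-unique⇒disjoint (map (b +_) (minkowski As)) u (∈-map⁺ (b +_) (∈Σ⇒∈minkowski c∈)))
  summand-unique (b ∷ A) As u (there a∈) c∈ (here ≡.refl) c′∈ eq = contradiction
    (subst (_∈ minkowski (A ∷ As)) eq (∈Σ⇒∈minkowski (a∈ ∷ c∈)))
    (++-unique⇒disjoint (map (b +_) (minkowski As)) u (∈-map⁺ (b +_) (∈Σ⇒∈minkowski c′∈)))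
  summand-unique (b ∷ A) As u (there a∈) c∈ (there a′∈) c′∈ eq =
    summand-unique A As (++-unique⁻ʳ (map (b +_) (minkowski As)) u) a∈ c∈ a′∈ c′∈ eq

  tiling⇒directSum : Tiling n (A ∷ As) → IsDirectSum n (_∈ A) (_∈Σ As)
  tiling⇒directSum {A = A} {As} t = record
    { bounded = λ a∈ c∈ → bounded t (a∈ ∷ c∈)
    ; covers  = ∈Σ-uncons ∘ covers t
    ; unique  = summand-unique A As (minkowski-unique t)
    }

  ∈Σ-scale⁺ : ∀ f → c ∈Σ Bs → (c * f) ∈Σ map (scale f) Bs
  ∈Σ-scale⁺ f [] = []
  ∈Σ-scale⁺ f (_∷_ {b} {c = c} b∈ c∈) =
    ∈Σ-resp-≡ (sym (*-distribʳ-+ f b c)) (∈-map⁺ (_* f) b∈ ∷ ∈Σ-scale⁺ f c∈)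

  ∈Σ-scale⁻ : ∀ f Bs → x ∈Σ map (scale f) Bs → ∃ λ c → c ∈Σ Bs × x ≡ c * f
  ∈Σ-scale⁻ f [] [] = 0 , [] , ≡.refl
  ∈Σ-scale⁻ f (B ∷ Bs) (a∈ ∷ x∈)
    with b , b∈ , ≡.refl ← ∈-map⁻ (_* f) a∈
    with c , c∈ , ≡.refl ← ∈Σ-scale⁻ f Bs x∈
    = b + c , b∈ ∷ c∈ , sym (*-distribʳ-+ f b c)

  lengths-scale : ∀ f Bs → map length (map (scale f) Bs) ≡ map length Bs
  lengths-scale f Bs = ≡.trans (sym (map-∘ Bs)) (map-cong (length-map (_* f)) Bs)

  product-expand : ∀ f B Bs → product (map length (expand f B ∷ map (scale f) Bs))
                              ≡ product (map length (B ∷ Bs)) * f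
  product-expand f B Bs = begin
    length (expand f B) * product (map length (map (scale f) Bs))
                       ≡⟨ cong₂ _*_ (length-expand f B) (cong product (lengths-scale f Bs)) ⟩
    length B * f * p   ≡⟨ *-assoc (length B) f p ⟩
    length B * (f * p) ≡⟨ cong (length B *_) (*-comm f p) ⟩
    length B * (p * f) ≡⟨ *-assoc (length B) p f ⟨
    length B * p * f   ∎
    where
    open ≡-Reasoning
    p = product (map length Bs)

  ∈Σ-expand⁺ : ∀ {r} → r < f → x ∈Σ (B ∷ Bs) → (r + x * f) ∈Σ (expand f B ∷ map (scale f) Bs)
  ∈Σ-expand⁺ {f} {r = r} r<f (_∷_ {b} {c = c} b∈ c∈) = ∈Σ-resp-≡
    (≡.trans (+-assoc r (b * f) (c * f)) (cong (r +_) (sym (*-distribʳ-+ f b c))))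
    (∈-expand⁺ b∈ r<f ∷ ∈Σ-scale⁺ f c∈)

  ∈Σ-expand⁻ : ∀ B Bs → x ∈Σ (expand f B ∷ map (scale f) Bs) →
               ∃₂ λ r y → r < f × y ∈Σ (B ∷ Bs) × x ≡ r + y * f
  ∈Σ-expand⁻ {f = f} B Bs (a∈ ∷ x∈)
    with b , r , b∈ , r<f , ≡.refl ← ∈-expand⁻ B a∈
    with c , c∈ , ≡.refl ← ∈Σ-scale⁻ f Bs x∈
    = r , b + c , r<f , b∈ ∷ c∈ ,
      ≡.trans (+-assoc r (b * f) (c * f)) (cong (r +_) (sym (*-distribʳ-+ f b c)))

  -- Division with remainder: the run [0,f) supplies x mod f, and the tiling of [0,d) supplies the
  -- quotient.
  tiling-expand⁺ : .{{NonZero f}} → ∀ B Bs → Tiling d (B ∷ Bs) → Tiling (d * f) (expand f B ∷ map (scale f) Bs)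
  tiling-expand⁺ {f} {d} B Bs t = record
    { product≡ = ≡.trans (product-expand f B Bs) (cong (_* f) (product≡ t))
    ; bounded  = bnd ∘ ∈Σ-expand⁻ B Bs
    ; covers   = λ {x} x< → ∈Σ-resp-≡ (sym (m≡m%n+[m/n]*n x f))
                   (∈Σ-expand⁺ (m%n<n x f) (covers t (m<n*o⇒m/o<n {x} {d} x<)))
    }
    where
    bnd : ∀ {x} → (∃₂ λ r y → r < f × y ∈Σ (B ∷ Bs) × x ≡ r + y * f) → x < d * f
    bnd (_ , y , r<f , y∈ , ≡.refl) =
      <-≤-trans (+-monoˡ-< (y * f) r<f) (*-monoˡ-≤ f (bounded t y∈))

  -- Only the multiples x f are inspected: by uniqueness of division their remainder is 0 and their
  -- quotient x is a sum from B and Bs.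
  tiling-expand⁻ : .{{NonZero f}} → ∀ B Bs → Tiling (d * f) (expand f B ∷ map (scale f) Bs) → Tiling d (B ∷ Bs)
  tiling-expand⁻ {f} {d} B Bs t = record
    { product≡ = *-cancelʳ-≡ _ _ f (≡.trans (sym (product-expand f B Bs)) (product≡ t))
    ; bounded  = λ {x} x∈ → *-cancelʳ-< f x d (bounded t (∈Σ-expand⁺ 0<f x∈))
    ; covers   = λ {x} x<d → cov x (∈Σ-expand⁻ B Bs (covers t (*-monoˡ-< f x<d)))
    }
    where
    0<f = >-nonZero⁻¹ f
    cov : ∀ x → (∃₂ λ r y → r < f × y ∈Σ (B ∷ Bs) × x * f ≡ r + y * f) → x ∈Σ (B ∷ Bs)
    cov x (_ , y , r<f , y∈ , eq) = ∈Σ-resp-≡ (sym (proj₂ (remainder-unique x y 0<f r<f eq))) y∈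

open Tilings

-- Dividing a sum system by its initial run, and the inverse operation

module Gluing where

  open import Data.Nat
  open import Data.Nat.DivMod using (_/_; m≡m%n+[m/n]*n; m%n<n)
  open import Data.Nat.Properties
  open import Relation.Binary.PropositionalEquality as ≡ using (_≡_; _≢_; cong; cong₂; subst; sym)

  private
    variable
      x y n d f c k : ℕ
      A B : List ℕ
      As Bs : List (List ℕ)

  firstGap : ∀ A n → n ∉ A → ∃ λ f → f ∉ A × (∀ {r} → r < f → r ∈ A)
  firstGap A n n∉ = case (search n)
    where
    Gap : Set
    Gap = ∃ λ f → f ∉ A × (∀ {r} → r < f → r ∈ A)
    search : ∀ n → (∀ {r} → r < n → r ∈ A) ⊎ Gap
    search zero = inj₁ λ ()
    search (suc n) with search n
    ... | inj₂ gap = inj₂ gap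
    ... | inj₁ full with n ∈? A
    ...   | no n∉ = inj₂ (n , n∉ , full)
    ...   | yes n∈ = inj₁ λ r<1+n → below (m<1+n⇒m<n∨m≡n r<1+n)
      where
      below : ∀ {r} → r < n ⊎ r ≡ n → r ∈ A
      below (inj₁ r<n) = full r<n
      below (inj₂ ≡.refl) = n∈
    case : (∀ {r} → r < n → r ∈ A) ⊎ Gap → Gap
    case (inj₁ full) = n , n∉ , full
    case (inj₂ gap) = gap

  -- The part containing 1 comes first, divided by its initial run; it may have become {0}.
  record Core (k d : ℕ) (B : List ℕ) (Bs : List (List ℕ)) : Set where
    field
      parts   : length Bs ≡ k
      sorted  : Sorted B
      sorteds : All Sorted Bs
      1∉      : 1 ∉ B
      2≤      : All (λ A → 2 ≤ length A) Bs
      tiling  : Tiling d (B ∷ Bs)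

  open Core

  glue : ℕ → List (List ℕ) → List (List ℕ)
  glue f []       = []
  glue f (B ∷ Bs) = expand f B ∷ map (scale f) Bs

  scale-sorted : .{{NonZero f}} → Sorted A → Sorted (scale f A)
  scale-sorted {f} A< = AllPairs.map⁺ (AllPairs.map (*-monoˡ-< f) A<)

  0∈core : 0 < d → Tiling d (B ∷ Bs) → 0 ∈ B
  0∈core 0<d t = proj₁ (0∈Σ⁻ (Tiling.covers t 0<d))

  module Decomposition
    (0<n : 0 < n) (A< : Sorted A) (As< : All Sorted As) (1∈A : 1 ∈ A)
    (2≤As : All (λ A → 2 ≤ length A) As) (t : Tiling n (A ∷ As))
    (g : ℕ) (g∉A : g ∉ A) (run : ∀ {r} → r < g → r ∈ A)
    where

    open Tiling t

    part<n : ∀ {C} → C ∈ A ∷ As → All (_< n) C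
    part<n C∈ = All.tabulate λ a∈ → bounded (part⊆Σ (covers 0<n) C∈ a∈)

    0∈A : 0 ∈ A
    0∈A = proj₁ (0∈Σ⁻ (covers 0<n))

    0∈As : 0 ∈Σ As
    0∈As = proj₂ (0∈Σ⁻ (covers 0<n))

    -- Both 0 and 1 lie in A; this is what makes `n / g` smaller than n.
    2≤g : 2 ≤ g
    2≤g = ≮⇒≥ λ g<2 → g∉A (small g g<2)
      where
      small : ∀ g → g < 2 → g ∈ A
      small 0 _ = 0∈A
      small 1 _ = 1∈A
      small (suc (suc _)) (s≤s (s≤s ()))

    instance
      g≢0 : NonZero g
      g≢0 = >-nonZero (<⇒≤ 2≤g)

    open Blocks (tiling⇒directSum t) g 0<n run g∉A using (N≡N∕f*f; C-multiple; A-start; A-fill)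

    -- One inclusion is the `start` half of the block lemma, the other its `fill` half.
    expand-contract : A ≡ expand g (contract g n A)
    expand-contract = sorted-ext A< (expand-sorted g (contract-sorted g n A))
      (λ {x} x∈ → subst (_∈ expand g (contract g n A)) (sym (m≡m%n+[m/n]*n x g))
        (∈-expand⁺ (∈-contract⁺ g (x / g) (part<n (here ≡.refl)) (A-start x∈)) (m%n<n x g)))
      (λ x∈ → from (∈-expand⁻ (contract g n A) x∈))
      where
      from : ∀ {x} → (∃₂ λ b r → b ∈ contract g n A × r < g × x ≡ r + b * g) → x ∈ A
      from (b , r , b∈ , r<g , ≡.refl) = A-fill b r<g (∈-contract⁻ g n A b∈)

    -- Padding with zeros puts each member of C into the sumset of the other parts, which consists
    -- of multiples of g.
    scale-contract : ∀ {C} → C ∈ As → scale g (contract g n C) ≡ C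
    scale-contract {C} C∈ = sorted-ext (scale-sorted (contract-sorted g n C)) (All.lookup As< C∈)
      (λ x∈ → from (∈-map⁻ (_* g) x∈))
      (λ {x} x∈ → let x≡ = C-multiple (part⊆Σ 0∈As C∈ x∈) in
        subst (_∈ scale g (contract g n C)) (sym x≡)
          (∈-map⁺ (_* g) (∈-contract⁺ g (x / g) (part<n (there C∈)) (subst (_∈ C) x≡ x∈))))
      where
      from : ∀ {x} → (∃ λ b → b ∈ contract g n C × x ≡ b * g) → x ∈ C
      from (b , b∈ , ≡.refl) = ∈-contract⁻ g n C b∈

    parts≡ : A ∷ As ≡ glue g (contract g n A ∷ map (contract g n) As)
    parts≡ = cong₂ _∷_ expand-contract
      (sym (≡.trans (sym (map-∘ As)) (map-id-local (All.tabulate scale-contract))))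

    core : Core (length As) (n / g) (contract g n A) (map (contract g n) As)
    core = record
      { parts   = length-map (contract g n) As
      ; sorted  = contract-sorted g n A
      ; sorteds = All.map⁺ (All.universal (contract-sorted g n) As)
      -- A quotient containing 1 would mean that the gap g belongs to A.
      ; 1∉      = λ 1∈ → g∉A (subst (_∈ A) (*-identityˡ g) (∈-contract⁻ g n A 1∈))
      ; 2≤      = All.map⁺ (All.tabulate λ {C} C∈ → subst (2 ≤_)
                    (≡.trans (cong length (sym (scale-contract C∈))) (length-map (_* g) (contract g n C)))
                    (All.lookup 2≤As C∈))
      ; tiling  = tiling-expand⁻ _ _ (≡.subst₂ Tiling N≡N∕f*f parts≡ t)
      }

  decompose : 0 < n → Sorted A → All Sorted As → 1 ∈ A → SumSystem n (A ∷ As) →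
              ∃₂ λ d f → ∃₂ λ B Bs → n ≡ d * f × 2 ≤ f × A ∷ As ≡ glue f (B ∷ Bs) × Core (length As) d B Bs
  decompose {n} {A} {As} 0<n A< As< 1∈A s with sumSystem⇒tiling s
  -- A gap exists because n is one: padded with zeros, a member n of A would be a sum that is not
  -- below n.
  ... | _ ∷ 2≤As , t with g , g∉A , run ← firstGap A n (λ n∈ → <-irrefl ≡.refl
          (Tiling.bounded t (part⊆Σ (Tiling.covers t 0<n) (here ≡.refl) n∈)))
    = _ , g , _ , _ , N≡N∕f*f , 2≤g , parts≡ , core
    where
    open Decomposition 0<n A< As< 1∈A 2≤As t g g∉A run
    open Blocks (tiling⇒directSum t) g 0<n run g∉A using (N≡N∕f*f)

  2≤length : x ∈ A → y ∈ A → x ≢ y → 2 ≤ length A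
  2≤length {A = _ ∷ _ ∷ _} _ _ _ = s≤s (s≤s z≤n)
  2≤length {A = _ ∷ []} (here ≡.refl) (here ≡.refl) x≢y = contradiction ≡.refl x≢y

  compose : 2 ≤ f → 0 < d → Core k d B Bs → SumSystem (d * f) (glue f (B ∷ Bs))
  compose {f} {d} {B = B} {Bs} 2≤f 0<d core = tiling⇒sumSystem
    -- The block of 0 ∈ B contains 0 and 1, so the expanded part is large enough even for B = {0}.
    (2≤length (∈-expand⁺ 0∈B (<⇒≤ 2≤f)) (∈-expand⁺ 0∈B 2≤f) (λ ())
     ∷ All.map⁺ (All.map (λ {C} → subst (2 ≤_) (sym (length-map (_* f) C))) (2≤ core)))
    (tiling-expand⁺ {{>-nonZero (<⇒≤ 2≤f)}} B Bs (tiling core))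
    where 0∈B = 0∈core 0<d (tiling core)

  ∉-expand : 0 < f → 1 ∉ A → f ∉ expand f A
  ∉-expand {f} {A} 0<f 1∉A f∈ =
    1∉A (∈-expand-block 0<f (subst (_∈ expand f A) (sym (*-identityˡ f)) f∈))

  ∈-expand-run : 0 ∈ B → x < f → x ∈ expand f B
  ∈-expand-run {x = x} 0∈B x<f = subst (_∈ _) (+-identityʳ x) (∈-expand⁺ 0∈B x<f)

  -- The run [0,g) of the right side cannot reach past f, which is missing from the left side. Used
  -- in both directions, this recovers f from the expanded part.
  expand-run : ∀ {g} → 0 < f → 1 ∉ A → 0 ∈ B → expand f A ≡ expand g B → g ≤ f
  expand-run 0<f 1∉A 0∈B eq = ≮⇒≥ λ f<g →
    ∉-expand 0<f 1∉A (subst (_ ∈_) (sym eq) (∈-expand-run 0∈B f<g))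

  glue-injective : ∀ {g l} → 0 < f → 0 < g → 0 < d → 0 < c → Core k d A As → Core l c B Bs →
                   glue f (A ∷ As) ≡ glue g (B ∷ Bs) → f ≡ g × A ∷ As ≡ B ∷ Bs
  glue-injective {f} 0<f 0<g 0<d 0<c coreA coreB eq
    with heads , tails ← ∷-injective eq
    with ≡.refl ← ≤-antisym (expand-run 0<g (1∉ coreB) (0∈core 0<d (tiling coreA)) (sym heads))
                            (expand-run 0<f (1∉ coreA) (0∈core 0<c (tiling coreB)) heads)
    = ≡.refl , cong₂ _∷_
      (expand-injective 0<f (sorted coreA) (sorted coreB) heads)
      (map-injective (map-injective (*-cancelʳ-≡ _ _ f {{>-nonZero 0<f}})) tails)

open Gluing

-- Lists of systems and cores, and the bijection between them

module Enumeration where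

  open import Data.Nat
  open import Data.Nat.Divisibility using (_∣_; _∣?_; m∣m*n)
  open import Data.Nat.DivMod using (m/n*n≡m)
  open import Data.Nat.Properties
  open import Relation.Binary.PropositionalEquality as ≡ using (_≡_; cong; cong₂; subst; sym; module ≡-Reasoning)

  private
    variable
      X : Set
      x n d f c k N : ℕ
      xs A B : List ℕ
      As Bs : List (List ℕ)

  ∈-sublists⁻ : ∀ xs → A ∈ sublists xs → x ∈ A → x ∈ xs
  ∈-sublists⁻ [] (here ≡.refl) ()
  ∈-sublists⁻ (x ∷ xs) A∈ y∈ with ∈-++⁻ (map (x ∷_) (sublists xs)) A∈
  ... | inj₂ A∈′ = there (∈-sublists⁻ xs A∈′ y∈)
  ... | inj₁ A∈′ with ∈-map⁻ (x ∷_) A∈′ | y∈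
  ...   | B , B∈ , ≡.refl | here y≡x = here y≡x
  ...   | B , B∈ , ≡.refl | there y∈B = there (∈-sublists⁻ xs B∈ y∈B)

  sublists-sorted : Sorted xs → A ∈ sublists xs → Sorted A
  sublists-sorted [] (here ≡.refl) = []
  sublists-sorted {x ∷ xs} (x< ∷ xs<) A∈ with ∈-++⁻ (map (x ∷_) (sublists xs)) A∈
  ... | inj₂ A∈′ = sublists-sorted xs< A∈′
  ... | inj₁ A∈′ with B , B∈ , ≡.refl ← ∈-map⁻ (x ∷_) A∈′ =
    All.tabulate (λ y∈ → All.lookup x< (∈-sublists⁻ xs B∈ y∈)) ∷ sublists-sorted xs< B∈

  ∈-sublists⁺ : Sorted xs → Sorted A → (∀ {x} → x ∈ A → x ∈ xs) → A ∈ sublists xs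
  ∈-sublists⁺ {[]} {[]} [] [] _ = here ≡.refl
  ∈-sublists⁺ {[]} {_ ∷ _} [] _ ⊆ with () ← ⊆ (here ≡.refl)
  ∈-sublists⁺ {x ∷ xs} {[]} (_ ∷ xs<) [] _ = ∈-++⁺ʳ (map (x ∷_) (sublists xs)) (∈-sublists⁺ xs< [] λ ())
  ∈-sublists⁺ {x ∷ xs} {a ∷ A} (x< ∷ xs<) A<@(a< ∷ A<′) ⊆ with ⊆ (here ≡.refl)
  ... | here ≡.refl = ∈-++⁺ˡ (∈-map⁺ (x ∷_) (∈-sublists⁺ xs< A<′ λ y∈ → drop (All.lookup a< y∈) (⊆ (there y∈))))
    where
    drop : ∀ {y} → x < y → y ∈ x ∷ xs → y ∈ xs
    drop x<x (here ≡.refl) = contradiction x<x (<-irrefl ≡.refl)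
    drop _ (there y∈) = y∈
  ... | there a∈ = ∈-++⁺ʳ (map (x ∷_) (sublists xs)) (∈-sublists⁺ xs< A< λ y∈ → drop y∈ (⊆ y∈))
    where
    drop : ∀ {y} → y ∈ a ∷ A → y ∈ x ∷ xs → y ∈ xs
    drop y∈ (here ≡.refl) = contradiction (All.lookup x< a∈) (≤⇒≯ (sorted-head≤ A< y∈))
    drop _ (there y∈) = y∈

  sublists-unique : Unique xs → Unique (sublists xs)
  sublists-unique [] = [] ∷ []
  sublists-unique {x ∷ xs} x∷xs!@(_ ∷ xs!) =
    Unique.++⁺ (Unique.map⁺ ∷-injectiveʳ (sublists-unique xs!)) (sublists-unique xs!) disjoint
    where
    disjoint : ∀ {A} → ¬ (A ∈ map (x ∷_) (sublists xs) × A ∈ sublists xs)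
    disjoint (A∈₁ , A∈₂) with _ , _ , ≡.refl ← ∈-map⁻ (x ∷_) A∈₁ =
      Unique.Unique[x∷xs]⇒x∉xs x∷xs! (∈-sublists⁻ xs A∈₂ (here ≡.refl))

  module _ {xs : List X} where

    ∈-tuples⁻ : ∀ k {t} → t ∈ tuples k xs → length t ≡ k × All (_∈ xs) t
    ∈-tuples⁻ zero (here ≡.refl) = ≡.refl , []
    ∈-tuples⁻ (suc k) t∈
      with _ , _ , x∈ , t∈′ , ≡.refl ← ∈-dependentProduct⁻ _∷_ {λ _ → tuples k xs} xs t∈
      with len , ∈xs ← ∈-tuples⁻ k t∈′ = cong suc len , x∈ ∷ ∈xs

    ∈-tuples⁺ : ∀ {t} → All (_∈ xs) t → t ∈ tuples (length t) xs
    ∈-tuples⁺ [] = here ≡.refl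
    ∈-tuples⁺ {_ ∷ t} (x∈ ∷ ∈xs) = ∈-dependentProduct⁺ _∷_ {λ _ → tuples (length t) xs} x∈ (∈-tuples⁺ ∈xs)

    tuples-unique : ∀ k → Unique xs → Unique (tuples k xs)
    tuples-unique zero _ = [] ∷ []
    tuples-unique (suc k) xs! = dependentProduct-unique _∷_ ∷-injective (λ _ → tuples-unique k xs!) xs!

  systems : ℕ → ℕ → List (List (List ℕ))
  systems k n = filter (sumSystem? n) (tuples k (sublists (upTo n)))

  systems-unique : ∀ k n → Unique (systems k n)
  systems-unique k n = Unique.filter⁺ (sumSystem? n) (tuples-unique k (sublists-unique (Unique.upTo⁺ n)))

  ∈-systems⁻ : ∀ k n → As ∈ systems k n → length As ≡ k × All Sorted As × SumSystem n As
  ∈-systems⁻ k n As∈ with As∈′ , s ← ∈-filter⁻ (sumSystem? n) {xs = tuples k (sublists (upTo n))} As∈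
    with len , ∈sub ← ∈-tuples⁻ k As∈′ = len , All.map (sublists-sorted (upTo-sorted n)) ∈sub , s

  ∈-systems⁺ : 0 < n → All Sorted As → SumSystem n As → As ∈ systems (length As) n
  ∈-systems⁺ {n} {As} 0<n As< s = ∈-filter⁺ (sumSystem? n) (∈-tuples⁺ (All.tabulate λ A∈ →
    ∈-sublists⁺ (upTo-sorted n) (All.lookup As< A∈) (λ a∈ → ∈-upTo⁺ (bounded (part⊆Σ (covers 0<n) A∈ a∈))))) s
    where open Tiling (proj₂ (sumSystem⇒tiling s))

  FirstHas1 : List (List ℕ) → Set
  FirstHas1 []      = ⊥
  FirstHas1 (A ∷ _) = 1 ∈ A

  firstHas1? : ∀ As → Dec (FirstHas1 As)
  firstHas1? []      = no λ ()
  firstHas1? (A ∷ _) = 1 ∈? A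

  cores : ℕ → ℕ → List (List (List ℕ))
  cores k d = filter (¬? ∘ firstHas1?) (systems (suc k) d) ++ map ([ 0 ] ∷_) (systems k d)

  tiling-0∷⁺ : Tiling d As → Tiling d ([ 0 ] ∷ As)
  tiling-0∷⁺ t = record
    { product≡ = ≡.trans (+-identityʳ _) product≡
    ; bounded  = λ { (here ≡.refl ∷ x∈) → bounded x∈ }
    ; covers   = λ x<d → here ≡.refl ∷ covers x<d
    }
    where open Tiling t

  tiling-0∷⁻ : Tiling d ([ 0 ] ∷ As) → Tiling d As
  tiling-0∷⁻ t = record
    { product≡ = ≡.trans (sym (+-identityʳ _)) product≡
    ; bounded  = λ x∈ → bounded (here ≡.refl ∷ x∈)
    ; covers   = λ x<d → tail (covers x<d)
    }
    where
    open Tiling t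
    tail : ∀ {x As} → x ∈Σ ([ 0 ] ∷ As) → x ∈Σ As
    tail (here ≡.refl ∷ x∈) = x∈

  ∈-cores⁻ : ∀ k d {Cs} → Cs ∈ cores k d → ∃₂ λ B Bs → Cs ≡ B ∷ Bs × Core k d B Bs
  ∈-cores⁻ k d Cs∈ with ∈-++⁻ (filter (¬? ∘ firstHas1?) (systems (suc k) d)) Cs∈
  ... | inj₁ Cs∈′ with Cs∈″ , ¬1 ← ∈-filter⁻ (¬? ∘ firstHas1?) {xs = systems (suc k) d} Cs∈′
    with ∈-systems⁻ (suc k) d Cs∈″
  ∈-cores⁻ k d {B ∷ Bs} Cs∈ | inj₁ _ | len , B< ∷ Bs< , s with _ ∷ 2≤ , t ← sumSystem⇒tiling s =
    B , Bs , ≡.refl , record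
      { parts = suc-injective len ; sorted = B< ; sorteds = Bs< ; 1∉ = ¬1 ; 2≤ = 2≤ ; tiling = t }
  ∈-cores⁻ k d Cs∈ | inj₂ Cs∈′ with Bs , Bs∈ , ≡.refl ← ∈-map⁻ ([ 0 ] ∷_) Cs∈′
    with len , Bs< , s ← ∈-systems⁻ k d Bs∈
    with 2≤ , t ← sumSystem⇒tiling s = [ 0 ] , Bs , ≡.refl , record
      { parts = len ; sorted = [] ∷ [] ; sorteds = Bs< ; 1∉ = λ { (here ()) } ; 2≤ = 2≤ ; tiling = tiling-0∷⁺ t }

  -- Since 0 ∈ B, a singleton B is {0} and is dropped; a longer B is large enough to count as a
  -- part.
  ∈-cores⁺ : ∀ k d → 0 < d → Core k d B Bs → B ∷ Bs ∈ cores k d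
  ∈-cores⁺ {[]} _ _ 0<d core with () ← 0∈core 0<d (Core.tiling core)
  ∈-cores⁺ {_ ∷ []} {Bs} _ d 0<d core@record { parts = ≡.refl } with here ≡.refl ← 0∈core 0<d (Core.tiling core) =
    ∈-++⁺ʳ (filter (¬? ∘ firstHas1?) (systems (suc (length Bs)) d))
      (∈-map⁺ ([ 0 ] ∷_) (∈-systems⁺ 0<d (Core.sorteds core)
        (tiling⇒sumSystem (Core.2≤ core) (tiling-0∷⁻ (Core.tiling core)))))
  ∈-cores⁺ {_ ∷ _ ∷ _} _ _ 0<d core@record { parts = ≡.refl } =
    ∈-++⁺ˡ (∈-filter⁺ (¬? ∘ firstHas1?)
      (∈-systems⁺ 0<d (Core.sorted core ∷ Core.sorteds core)
        (tiling⇒sumSystem (s≤s (s≤s z≤n) ∷ Core.2≤ core) (Core.tiling core))) (Core.1∉ core))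

  -- The two families are disjoint because {0} is too small to be a part of a system.
  cores-unique : ∀ k d → Unique (cores k d)
  cores-unique k d = Unique.++⁺ (Unique.filter⁺ (¬? ∘ firstHas1?) (systems-unique (suc k) d))
    (Unique.map⁺ ∷-injectiveʳ (systems-unique k d)) disjoint
    where
    disjoint : ∀ {As} → ¬ (As ∈ filter (¬? ∘ firstHas1?) (systems (suc k) d) × As ∈ map ([ 0 ] ∷_) (systems k d))
    disjoint (∈₁ , ∈₂) with _ , _ , ≡.refl ← ∈-map⁻ ([ 0 ] ∷_) ∈₂
      with ∈-systems⁻ (suc k) d (proj₁ (∈-filter⁻ (¬? ∘ firstHas1?) {xs = systems (suc k) d} ∈₁))
    ... | _ , _ , (s≤s () ∷ _) , _

  ∈-properDivisors⁻ : ∀ N → d ∈ properDivisors N → 0 < d × d < N × d ∣ N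
  ∈-properDivisors⁻ N d∈ with d∈′ , d∣N ← ∈-filter⁻ (_∣? N) {xs = applyUpTo suc (N ∸ 1)} d∈
    with _ , i< , ≡.refl ← ∈-applyUpTo⁻ suc d∈′ = z<s , m<o∸n⇒n+m<o N i< , d∣N
    where
    m<o∸n⇒n+m<o : ∀ {m} N → m < N ∸ 1 → suc m < N
    m<o∸n⇒n+m<o (suc N) m<N = s≤s m<N

  ∈-properDivisors⁺ : 0 < d → d < N → d ∣ N → d ∈ properDivisors N
  ∈-properDivisors⁺ {suc d} {suc N} _ (s≤s d<N) d∣N = ∈-filter⁺ (_∣? suc N) (∈-applyUpTo⁺ suc d<N) d∣N

  properDivisors-unique : ∀ N → Unique (properDivisors N)
  properDivisors-unique N = Unique.filter⁺ (_∣? N)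
    (Unique.applyUpTo⁺₁ suc (N ∸ 1) λ i<j _ eq → <⇒≢ i<j (suc-injective eq))

  *-div : 0 < d → d ∣ N → d * (N div d) ≡ N
  *-div {d@(suc _)} {N} _ d∣N = ≡.trans (*-comm d (N div d)) (m/n*n≡m d∣N)

  div-unique : 0 < d → d * f ≡ N → N div d ≡ f
  div-unique {d@(suc _)} {f} {N} 0<d eq = *-cancelˡ-≡ (N div d) f d
    (≡.trans (*-div 0<d (subst (d ∣_) eq (m∣m*n f))) (sym eq))

  2≤div : 0 < d → d < N → d ∣ N → 2 ≤ N div d
  2≤div {d} {N} 0<d d<N d∣N = *-cancelˡ-< d 1 (N div d)
    (subst₂ _<_ (sym (*-identityʳ d)) (sym (*-div 0<d d∣N)) d<N)
    where open ≡ using (subst₂)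

  firsts : ℕ → ℕ → List (List (List ℕ))
  firsts k N = filter firstHas1? (systems (suc k) N)

  divisorCores : ℕ → ℕ → List (ℕ × List (List ℕ))
  divisorCores k N = concatMap (λ d → map (d ,_) (cores k d)) (properDivisors N)

  ∈-divisorCores⁻ : ∀ k N {Cs} → (d , Cs) ∈ divisorCores k N → 0 < d × d < N × d ∣ N × Cs ∈ cores k d
  ∈-divisorCores⁻ k N ∈dc with _ , _ , d∈ , Cs∈ , ≡.refl ← ∈-dependentProduct⁻ _,_ {cores k} (properDivisors N) ∈dc
    with 0<d , d<N , d∣N ← ∈-properDivisors⁻ N d∈ = 0<d , d<N , d∣N , Cs∈

  unfold : ℕ → ℕ × List (List ℕ) → List (List ℕ)
  unfold N (d , Cs) = glue (N div d) Cs

  -- The glued parts determine the factor, and the factor N / d determines d.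
  unfold-injective : ∀ k N {p q} → p ∈ divisorCores k N → q ∈ divisorCores k N → unfold N p ≡ unfold N q → p ≡ q
  unfold-injective k N {d , _} {c , _} p∈ q∈ eq
    with 0<d , d<N , d∣N , As∈ ← ∈-divisorCores⁻ k N p∈
    with 0<c , c<N , c∣N , Bs∈ ← ∈-divisorCores⁻ k N q∈
    with A , As , ≡.refl , coreA ← ∈-cores⁻ k d As∈
    with B , Bs , ≡.refl , coreB ← ∈-cores⁻ k c Bs∈
    with f≡g , As≡Bs ← glue-injective (<⇒≤ (2≤div 0<d d<N d∣N)) (<⇒≤ (2≤div 0<c c<N c∣N)) 0<d 0<c coreA coreB eq
    = cong₂ _,_ (*-cancelʳ-≡ d c (N div d) {{>-nonZero (<⇒≤ (2≤div 0<d d<N d∣N))}} (begin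
        d * (N div d) ≡⟨ *-div 0<d d∣N ⟩
        N             ≡⟨ *-div 0<c c∣N ⟨
        c * (N div c) ≡⟨ cong (c *_) f≡g ⟨
        c * (N div d) ∎)) As≡Bs
    where open ≡-Reasoning

  -- The central bijection: `to` rests on `compose`, `from` on `decompose`, whose factor is
  -- identified with `N div d`.
  firsts-↭ : ∀ k N → 0 < N → map (unfold N) (divisorCores k N) ↭ firsts k N
  firsts-↭ k N 0<N = unique∧set⇒↭
    (map⁺-unique (unfold N) (unfold-injective k N)
      (dependentProduct-unique _,_ ,-injective (cores-unique k) (properDivisors-unique N)))
    (Unique.filter⁺ firstHas1? (systems-unique (suc k) N))
    (λ As∈ → to (∈-map⁻ (unfold N) As∈)) from
    where
    to : ∀ {As} → (∃ λ p → p ∈ divisorCores k N × As ≡ unfold N p) → As ∈ firsts k N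
    to ((d , _) , p∈ , ≡.refl) with 0<d , d<N , d∣N , Bs∈ ← ∈-divisorCores⁻ k N p∈
      with B , Bs , ≡.refl , core ← ∈-cores⁻ k d Bs∈
      = ∈-filter⁺ firstHas1?
        (subst (λ l → unfold N (d , B ∷ Bs) ∈ systems (suc l) N)
          (≡.trans (length-map (scale (N div d)) Bs) (Core.parts core))
          (∈-systems⁺ 0<N
            (expand-sorted (N div d) (Core.sorted core)
             ∷ All.map⁺ (All.map (scale-sorted {{>-nonZero (<⇒≤ 2≤f)}}) (Core.sorteds core)))
            (subst (λ n → SumSystem n (unfold N (d , B ∷ Bs))) (*-div 0<d d∣N) (compose 2≤f 0<d core))))
        (∈-expand⁺ (0∈core 0<d (Core.tiling core)) 2≤f)
      where 2≤f = 2≤div 0<d d<N d∣N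
    from : ∀ {As} → As ∈ firsts k N → As ∈ map (unfold N) (divisorCores k N)
    from {As} As∈ with As∈′ , 1∈ ← ∈-filter⁻ firstHas1? {xs = systems (suc k) N} As∈
      with As | ∈-systems⁻ (suc k) N As∈′
    ... | A ∷ As | ≡.refl , A< ∷ As< , s
      with d , f , B , Bs , N≡ , 2≤f , eq , core ← decompose 0<N A< As< 1∈ s
      = subst (_∈ map (unfold N) (divisorCores k N))
          (≡.trans (cong (λ f → glue f (B ∷ Bs)) (div-unique 0<d (sym N≡))) (sym eq))
          (∈-map⁺ (unfold N) (∈-dependentProduct⁺ _,_ {cores k} {xs = properDivisors N}
            (∈-properDivisors⁺ 0<d d<N (subst (d ∣_) (sym N≡) (m∣m*n f)))
            (∈-cores⁺ k d 0<d core)))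
      where
      0<d : 0 < d
      0<d = n≢0⇒n>0 λ { ≡.refl → <⇒≢ 0<N (sym N≡) }
      d<N : d < N
      d<N = subst (d <_) (sym N≡) (m<m*n d f {{>-nonZero 0<d}} 2≤f)

open Enumeration

-- Exchanging the parts, and the recurrence in ℕ

module Symmetry where

  open import Data.Nat
  open import Data.Nat.Properties
  open import Data.Nat.ListAction using (product)
  open import Relation.Binary.PropositionalEquality as ≡ using (_≡_; _≢_; cong; cong₂; sym; trans; module ≡-Reasoning)

  open Summation +-*-commutativeSemiring

  private
    variable
      X : Set
      n k : ℕ
      As : List (List ℕ)

  Σ-tuples-suc : ∀ k (xs : List X) (w : List X → ℕ) →
                 Σ[ tuples (suc k) xs ] w ≡ Σ[ xs ] (λ a → Σ[ tuples k xs ] (w ∘ (a ∷_)))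
  Σ-tuples-suc k xs w = trans (Σ-concatMap (λ a → map (a ∷_) (tuples k xs)) xs w)
    (Σ-cong xs (λ {a} _ → Σ-map (a ∷_) (tuples k xs) w))

  head-weight : (X → ℕ) → List X → ℕ
  head-weight q []      = 0
  head-weight q (a ∷ _) = q a

  -- By symmetry of w, each of the k positions contributes as much as the first one.
  Σ-tuples-symmetric : ∀ k (xs : List X) (w : List X → ℕ) (q : X → ℕ) →
                       (∀ {s t} → s ↭ t → w s ≡ w t) →
                       Σ[ tuples k xs ] (λ t → w t * Σ[ t ] q) ≡
                       k * Σ[ tuples k xs ] (λ t → w t * head-weight q t)
  Σ-tuples-symmetric zero xs w q w-resp = trans (+-identityʳ _) (*-zeroʳ (w []))
  Σ-tuples-symmetric (suc k) xs w q w-resp = begin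
    Σ[ tuples (suc k) xs ] (λ t → w t * Σ[ t ] q)
      ≡⟨ Σ-tuples-suc k xs _ ⟩
    Σ[ xs ] (λ a → Σ[ tuples k xs ] (λ t → w (a ∷ t) * (q a + Σ[ t ] q)))
      ≡⟨ Σ-cong xs (λ {a} _ → trans
           (Σ-cong (tuples k xs) (λ {t} _ → *-distribˡ-+ (w (a ∷ t)) (q a) (Σ[ t ] q)))
           (Σ-+ (tuples k xs) (λ t → w (a ∷ t) * q a) (λ t → w (a ∷ t) * Σ[ t ] q))) ⟩
    Σ[ xs ] (λ a → Σ[ tuples k xs ] (λ t → w (a ∷ t) * q a)
                 + Σ[ tuples k xs ] (λ t → w (a ∷ t) * Σ[ t ] q))
      ≡⟨ Σ-+ xs _ _ ⟩
    Σ[ xs ] (λ a → Σ[ tuples k xs ] (λ t → w (a ∷ t) * q a))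
      + Σ[ xs ] (λ a → Σ[ tuples k xs ] (λ t → w (a ∷ t) * Σ[ t ] q))
      -- With the head a fixed, `w ∘ (a ∷_)` is again symmetric, so induction moves the tail weight
      -- to the second position.
      ≡⟨ cong₂ _+_ (sym (Σ-tuples-suc k xs _)) (trans
           (Σ-cong xs (λ {a} _ → Σ-tuples-symmetric k xs (w ∘ (a ∷_)) q (w-resp ∘ prep a)))
           (Σ-*ˡ xs k _)) ⟩
    H + k * Σ[ xs ] (λ a → Σ[ tuples k xs ] (λ t → w (a ∷ t) * head-weight q t))
      ≡⟨ cong (H +_) (second k) ⟩
    H + k * Σ[ xs ] (λ a → Σ[ tuples k xs ] (λ t → w (a ∷ t) * q a))
      ≡⟨ cong (λ h → H + k * h) (Σ-tuples-suc k xs _) ⟨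
    suc k * H ∎
    where
    open ≡-Reasoning
    H : ℕ
    H = Σ[ tuples (suc k) xs ] (λ t → w t * head-weight q t)
    -- Exchanges the first two positions. The factor k stays in the claim because for k = 0 there is
    -- no second position and the sums themselves may differ.
    second : ∀ k → k * Σ[ xs ] (λ a → Σ[ tuples k xs ] (λ t → w (a ∷ t) * head-weight q t)) ≡
                   k * Σ[ xs ] (λ a → Σ[ tuples k xs ] (λ t → w (a ∷ t) * q a))
    second zero = ≡.refl
    second (suc j) = cong (suc j *_) (begin
      Σ[ xs ] (λ a → Σ[ tuples (suc j) xs ] (λ t → w (a ∷ t) * head-weight q t))
        ≡⟨ Σ-cong xs (λ _ → Σ-tuples-suc j xs _) ⟩
      Σ[ xs ] (λ a → Σ[ xs ] (λ b → Σ[ tuples j xs ] (λ s → w (a ∷ b ∷ s) * q b)))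
        ≡⟨ Σ-swap xs xs _ ⟩
      Σ[ xs ] (λ b → Σ[ xs ] (λ a → Σ[ tuples j xs ] (λ s → w (a ∷ b ∷ s) * q b)))
        ≡⟨ Σ-cong xs (λ {b} _ → Σ-cong xs (λ {a} _ → Σ-cong (tuples j xs) (λ {s} _ →
             cong (_* q b) (w-resp (swap a b ↭-refl))))) ⟩
      Σ[ xs ] (λ b → Σ[ xs ] (λ a → Σ[ tuples j xs ] (λ s → w (b ∷ a ∷ s) * q b)))
        ≡⟨ Σ-cong xs (λ _ → Σ-tuples-suc j xs _) ⟨
      Σ[ xs ] (λ b → Σ[ tuples (suc j) xs ] (λ t → w (b ∷ t) * q b)) ∎)

  has1 : List ℕ → ℕ
  has1 A = ⟦ 1 ∈? A ⟧

  ∉Σ⇒Σ-has1≡0 : ∀ As → 0 ∈Σ As → ¬ 1 ∈Σ As → Σ[ As ] has1 ≡ 0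
  ∉Σ⇒Σ-has1≡0 As 0∈ 1∉ = trans (Σ-cong As λ {A} A∈ → vanish A λ 1∈A → 1∉ (part⊆Σ 0∈ A∈ 1∈A)) (Σ-zero As)
    where
    vanish : ∀ A → 1 ∉ A → has1 A ≡ 0
    vanish A 1∉A with 1 ∈? A
    ... | yes 1∈A = contradiction 1∈A 1∉A
    ... | no _ = ≡.refl

  -- If 1 lies in A and also in the sumset of the rest, then 1 + 0 = 0 + 1 are two representations.
  -- If 1 ∉ A, then 1 = 0 + 1 passes to the rest.
  Σ-has1≡1 : ∀ As → Unique (minkowski As) → 0 ∈Σ As → 1 ∈Σ As → Σ[ As ] has1 ≡ 1
  Σ-has1≡1 (A ∷ As) u 0∈ 1∈ with 1 ∈? A
  ... | yes 1∈A = cong suc (∉Σ⇒Σ-has1≡0 As 0∈As λ 1∈As →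
          contradiction (summand-unique A As u 1∈A 0∈As 0∈A 1∈As ≡.refl) λ ())
    where
    0∈A = proj₁ (0∈Σ⁻ 0∈)
    0∈As = proj₂ (0∈Σ⁻ 0∈)
  ... | no 1∉A with 0∈A , 0∈As ← 0∈Σ⁻ 0∈ =
    Σ-has1≡1 As (minkowski-unique-tail A As 0∈A u) 0∈As (1∈As (∈Σ-uncons 1∈))
    where
    1∈As : (∃₂ λ a c → a ∈ A × c ∈Σ As × 1 ≡ a + c) → 1 ∈Σ As
    1∈As (0 , c , _ , c∈ , ≡.refl) = c∈
    1∈As (1 , 0 , 1∈A , _) = contradiction 1∈A 1∉A

  sumSystem-has1 : ∀ k → 0 < n → As ∈ systems (suc k) n → Σ[ As ] has1 ≡ 1
  sumSystem-has1 {n} {As} k 0<n As∈ with _ , _ , s ← ∈-systems⁻ (suc k) n As∈ with As | s | sumSystem⇒tiling s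
  ... | A ∷ As | _ | 2≤A ∷ _ , t = Σ-has1≡1 (A ∷ As) (minkowski-unique t) (covers 0<n) (covers 1<n)
    where
    open Tiling t
    p = product (map length As)
    p≢0 : p ≢ 0
    p≢0 p≡0 = <⇒≢ 0<n (trans (sym (trans (cong (length A *_) p≡0) (*-zeroʳ (length A)))) product≡)
    -- |A| ≥ 2, and the remaining factor of n is nonzero.
    1<n : 1 < n
    1<n = ≤-trans 2≤A (≤-trans (m≤m*n (length A) p {{≢-nonZero p≢0}}) (≤-reflexive product≡))

  -- Exactly one part of a sum system generating 0,…,n-1 with n ≥ 2 contains 1.
  𝒩≡k*firsts : ∀ k → 0 < n → 𝒩 (suc k) n ≡ suc k * length (firsts k n)
  𝒩≡k*firsts {n} k 0<n = begin
    -- Each system counts with weight 1, the number of its parts containing 1. Turning the filter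
    -- into a weight `w` extends the sum to all tuples, where positions may be exchanged.
    𝒩 (suc k) n                            ≡⟨ Σ-cong (systems (suc k) n) (sumSystem-has1 k 0<n) ⟨
    Σ[ systems (suc k) n ] (λ As → Σ[ As ] has1) ≡⟨ Σ-filter (sumSystem? n) T _ ⟩
    Σ[ T ] (λ As → w As * Σ[ As ] has1)      ≡⟨ Σ-tuples-symmetric (suc k) (sublists (upTo n)) w has1 w-resp ⟩
    suc k * Σ[ T ] (λ As → w As * head-weight has1 As)
      ≡⟨ cong (suc k *_) (Σ-filter (sumSystem? n) T _) ⟨
    suc k * Σ[ systems (suc k) n ] (head-weight has1)
      ≡⟨ cong (suc k *_) (Σ-cong (systems (suc k) n) (λ {As} _ → head≡ As)) ⟩
    suc k * Σ[ systems (suc k) n ] (λ As → ⟦ firstHas1? As ⟧)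
      ≡⟨ cong (suc k *_) (trans (Σ-filter firstHas1? (systems (suc k) n) (λ _ → 1))
        (Σ-cong (systems (suc k) n) (λ _ → *-identityʳ _))) ⟨
    suc k * length (firsts k n) ∎
    where
    open ≡-Reasoning
    T : List (List (List ℕ))
    T = tuples (suc k) (sublists (upTo n))
    w : List (List ℕ) → ℕ
    w As = ⟦ sumSystem? n As ⟧
    w-resp : ∀ {As Bs} → As ↭ Bs → w As ≡ w Bs
    w-resp {As} {Bs} p = cong (if_then 1 else 0)
      (does-⇔ (mk⇔ (sumSystem-↭ p) (sumSystem-↭ (↭-sym p))) (sumSystem? n As) (sumSystem? n Bs))
    head≡ : ∀ As → head-weight has1 As ≡ ⟦ firstHas1? As ⟧
    head≡ [] = ≡.refl
    head≡ (_ ∷ _) = ≡.refl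

  length-cores : ∀ k d → 0 < d → suc k * length (cores k d) ≡ k * 𝒩 (suc k) d + suc k * 𝒩 k d
  length-cores k d 0<d = begin
    suc k * length (cores k d)
      ≡⟨ cong (suc k *_) (trans (length-++ rest) (cong (length rest +_) (length-map _ (systems k d)))) ⟩
    suc k * (length rest + 𝒩 k d) ≡⟨ *-distribˡ-+ (suc k) (length rest) (𝒩 k d) ⟩
    suc k * length rest + suc k * 𝒩 k d ≡⟨ cong (_+ suc k * 𝒩 k d) rest≡ ⟩
    k * 𝒩 (suc k) d + suc k * 𝒩 k d ∎
    where
    open ≡-Reasoning
    rest : List (List (List ℕ))
    rest = filter (¬? ∘ firstHas1?) (systems (suc k) d)
    -- `firsts` takes the share 1/(k+1) of the systems and `rest` the share k/(k+1). Adding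
    -- `𝒩 (suc k) d` on both sides avoids subtraction in ℕ.
    rest≡ : suc k * length rest ≡ k * 𝒩 (suc k) d
    rest≡ = +-cancelʳ-≡ (𝒩 (suc k) d) _ _ (begin
      suc k * length rest + 𝒩 (suc k) d ≡⟨ cong (suc k * length rest +_) (𝒩≡k*firsts k 0<d) ⟩
      suc k * length rest + suc k * length (firsts k d) ≡⟨ +-comm (suc k * length rest) _ ⟩
      suc k * length (firsts k d) + suc k * length rest ≡⟨ *-distribˡ-+ (suc k) (length (firsts k d)) _ ⟨
      suc k * (length (firsts k d) + length rest)
        ≡⟨ cong (suc k *_) (Σ-partition firstHas1? (systems (suc k) d) (λ _ → 1)) ⟨
      suc k * 𝒩 (suc k) d ≡⟨ +-comm (𝒩 (suc k) d) _ ⟩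
      k * 𝒩 (suc k) d + 𝒩 (suc k) d ∎)

  -- Stated from N = 1 on because Möbius inversion evaluates it at every divisor. The factor k+1 is
  -- carried inside the sum, where it clears the fraction k/(k+1).
  recurrence : ∀ k N → 0 < N →
               𝒩 (suc k) N ≡ Σ[ properDivisors N ] (λ d → k * 𝒩 (suc k) d + suc k * 𝒩 k d)
  recurrence k N 0<N = begin
    𝒩 (suc k) N                    ≡⟨ 𝒩≡k*firsts k 0<N ⟩
    suc k * length (firsts k N)     ≡⟨ cong (suc k *_) (↭-length (firsts-↭ k N 0<N)) ⟨
    suc k * length (map (unfold N) (divisorCores k N)) ≡⟨ cong (suc k *_) (length-map (unfold N) (divisorCores k N)) ⟩
    suc k * length (divisorCores k N)
      ≡⟨ cong (suc k *_) (Σ-concatMap (λ d → map (d ,_) (cores k d)) (properDivisors N) (λ _ → 1)) ⟩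
    suc k * Σ[ properDivisors N ] (λ d → length (map (d ,_) (cores k d))) ≡⟨ Σ-*ˡ (properDivisors N) (suc k) _ ⟨
    Σ[ properDivisors N ] (λ d → suc k * length (map (d ,_) (cores k d)))
      ≡⟨ Σ-cong (properDivisors N) (λ {d} d∈ → trans (cong (suc k *_) (length-map (d ,_) (cores k d)))
           (length-cores k d (proj₁ (∈-properDivisors⁻ N d∈)))) ⟩
    Σ[ properDivisors N ] (λ d → k * 𝒩 (suc k) d + suc k * 𝒩 k d) ∎
    where open ≡-Reasoning

open Symmetry

-- The Möbius function and Möbius inversion

module Möbius where

  open import Data.Integer as ℤ using (ℤ; 0ℤ; 1ℤ)
  import Data.Integer.Properties as ℤ
  open import Data.Nat as ℕ using (ℕ; zero; suc; _<_; _≤_; z<s; s≤s; NonZero; >-nonZero; >-nonZero⁻¹)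
  open import Data.Nat.Divisibility
  open import Data.Nat.ListAction using (product)
  open import Data.Nat.Primality using (Prime; prime?; prime⇒nonZero; euclidsLemma; prime⇒irreducible; prime⇒nonTrivial)
  open import Data.Nat.Primality.Factorisation using (factorise)
  import Data.Nat.Properties as ℕ
  open import Relation.Binary.PropositionalEquality as ≡ using (_≡_; cong; cong₂; subst; sym; trans; module ≡-Reasoning)

  open Summation ℤ.+-*-commutativeSemiring

  private
    variable
      d e n p q N : ℕ

  divisors : ℕ → List ℕ
  divisors N = filter (_∣? N) (applyUpTo suc N)

  ∈-divisors⁻ : ∀ N → d ∈ divisors N → 0 < d × d ∣ N
  ∈-divisors⁻ N d∈ with d∈′ , d∣N ← ∈-filter⁻ (_∣? N) {xs = applyUpTo suc N} d∈
    with _ , _ , ≡.refl ← ∈-applyUpTo⁻ suc d∈′ = z<s , d∣N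

  ∣⇒0< : 0 < N → d ∣ N → 0 < d
  ∣⇒0< {d = zero} 0<N d∣N = contradiction (sym (0∣⇒≡0 d∣N)) (ℕ.<⇒≢ 0<N)
  ∣⇒0< {d = suc _} _ _ = z<s

  ∈-divisors⁺ : 0 < N → d ∣ N → d ∈ divisors N
  ∈-divisors⁺ {N} {d} 0<N d∣N with d | ∣⇒0< 0<N d∣N | ∣⇒≤ {{>-nonZero 0<N}} d∣N | d∣N
  ... | suc d | _ | d<N | d∣N = ∈-filter⁺ (_∣? N) (∈-applyUpTo⁺ suc d<N) d∣N

  divisors-unique : ∀ N → Unique (divisors N)
  divisors-unique N = Unique.filter⁺ (_∣? N)
    (Unique.applyUpTo⁺₁ suc N λ i<j _ eq → ℕ.<⇒≢ i<j (ℕ.suc-injective eq))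

  divisors-↭ : 0 < N → divisors N ↭ N ∷ properDivisors N
  divisors-↭ {N} 0<N = unique∧set⇒↭ (divisors-unique N)
    (All.tabulate (λ d∈ N≡d → ℕ.<⇒≢ (proj₁ (proj₂ (∈-properDivisors⁻ N d∈))) (sym N≡d)) ∷ properDivisors-unique N)
    to from
    where
    to : ∀ {d} → d ∈ divisors N → d ∈ N ∷ properDivisors N
    to {d} d∈ with 0<d , d∣N ← ∈-divisors⁻ N d∈ with ℕ.m≤n⇒m<n∨m≡n (∣⇒≤ {{>-nonZero 0<N}} d∣N)
    ... | inj₁ d<N = there (∈-properDivisors⁺ 0<d d<N d∣N)
    ... | inj₂ d≡N = here d≡N
    from : ∀ {d} → d ∈ N ∷ properDivisors N → d ∈ divisors N
    from (here ≡.refl) = ∈-divisors⁺ 0<N ∣-refl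
    from (there d∈) = ∈-divisors⁺ 0<N (proj₂ (proj₂ (∈-properDivisors⁻ N d∈)))

  SquareFree : ℕ → Set
  SquareFree n = All (λ p → ¬ (p ℕ.* p ∣ n)) (primeDivisors n)

  primeDivisors-unique : ∀ n → Unique (primeDivisors n)
  primeDivisors-unique n = Unique.filter⁺ (λ p → prime? p ×-dec (p ∣? n)) (Unique.upTo⁺ (suc n))

  ∈-primeDivisors⁻ : ∀ n → p ∈ primeDivisors n → Prime p × p ∣ n
  ∈-primeDivisors⁻ n p∈ = proj₂ (∈-filter⁻ (λ p → prime? p ×-dec (p ∣? n)) {xs = upTo (suc n)} p∈)

  ∈-primeDivisors⁺ : 0 < n → Prime p → p ∣ n → p ∈ primeDivisors n
  ∈-primeDivisors⁺ {n} 0<n p-prime p∣n = ∈-filter⁺ (λ p → prime? p ×-dec (p ∣? n))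
    (∈-upTo⁺ (s≤s (∣⇒≤ {{>-nonZero 0<n}} p∣n))) (p-prime , p∣n)

  μ-squareFree : 0 < n → SquareFree n → μ n ≡ (ℤ.- 1ℤ) ℤ.^ length (primeDivisors n)
  μ-squareFree {n@(suc _)} _ sf with squareFree? n
  ... | yes _ = ≡.refl
  ... | no ¬sf = contradiction sf ¬sf

  μ-¬squareFree : ¬ SquareFree n → μ n ≡ 0ℤ
  μ-¬squareFree {zero} ¬sf = ≡.refl
  μ-¬squareFree {n@(suc _)} ¬sf with squareFree? n
  ... | yes sf = contradiction sf ¬sf
  ... | no _ = ≡.refl

  prime∣prime : Prime p → Prime q → q ∣ p → q ≡ p
  prime∣prime p-prime q-prime q∣p with prime⇒irreducible p-prime q∣p
  ... | inj₂ q≡p = q≡p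
  ... | inj₁ q≡1 = contradiction q≡1 (ℕ.nonTrivial⇒≢1 {{prime⇒nonTrivial q-prime}})

  0<prime* : Prime p → 0 < e → 0 < p ℕ.* e
  0<prime* {p} {e} p-prime 0<e = ℕ.*-mono-< (>-nonZero⁻¹ p {{prime⇒nonZero p-prime}}) 0<e

  -- For q = p, cancelling p would give p ∣ e. Otherwise Euclid's lemma, applied twice, moves both
  -- factors q into e.
  square∣prime* : Prime p → Prime q → ¬ p ∣ e → q ℕ.* q ∣ p ℕ.* e → q ℕ.* q ∣ e
  square∣prime* {p} {q} {e} p-prime q-prime p∤e q²∣pe with q ℕ.≟ p
  ... | yes ≡.refl = contradiction (*-cancelˡ-∣ p {{prime⇒nonZero p-prime}} q²∣pe) p∤e
  ... | no q≢p with euclidsLemma p e q-prime (∣-trans (m∣m*n q) q²∣pe)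
  ...   | inj₁ q∣p = contradiction (prime∣prime p-prime q-prime q∣p) q≢p
  ...   | inj₂ (divides-refl f) with euclidsLemma p f q-prime
            (*-cancelʳ-∣ q {{prime⇒nonZero q-prime}} (subst (q ℕ.* q ∣_) (sym (ℕ.*-assoc p f q)) q²∣pe))
  ...     | inj₁ q∣p = contradiction (prime∣prime p-prime q-prime q∣p) q≢p
  ...     | inj₂ q∣f = *-monoˡ-∣ q q∣f

  primeDivisors-prime* : Prime p → 0 < e → ¬ p ∣ e → primeDivisors (p ℕ.* e) ↭ p ∷ primeDivisors e
  primeDivisors-prime* {p} {e} p-prime 0<e p∤e = unique∧set⇒↭ (primeDivisors-unique (p ℕ.* e))
    (All.tabulate (λ {q} q∈ p≡q → p∤e (subst (_∣ e) (sym p≡q) (proj₂ (∈-primeDivisors⁻ e q∈))))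
     ∷ primeDivisors-unique e)
    to from
    where
    to : ∀ {q} → q ∈ primeDivisors (p ℕ.* e) → q ∈ p ∷ primeDivisors e
    to q∈ with q-prime , q∣pe ← ∈-primeDivisors⁻ (p ℕ.* e) q∈ with euclidsLemma p e q-prime q∣pe
    ... | inj₁ q∣p = here (prime∣prime p-prime q-prime q∣p)
    ... | inj₂ q∣e = there (∈-primeDivisors⁺ 0<e q-prime q∣e)
    from : ∀ {q} → q ∈ p ∷ primeDivisors e → q ∈ primeDivisors (p ℕ.* e)
    from (here ≡.refl) = ∈-primeDivisors⁺ (0<prime* p-prime 0<e) p-prime (m∣m*n e)
    from (there q∈) with q-prime , q∣e ← ∈-primeDivisors⁻ e q∈ =
      ∈-primeDivisors⁺ (0<prime* p-prime 0<e) q-prime (∣n⇒∣m*n p q∣e)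

  -- Multiplying by a new prime preserves square-freeness and its failure, and adds one prime
  -- divisor, which flips the sign.
  μ-prime*-coprime : Prime p → 0 < e → ¬ p ∣ e → μ (p ℕ.* e) ≡ ℤ.- μ e
  μ-prime*-coprime {p} {e} p-prime 0<e p∤e with squareFree? e
  ... | yes sf = begin
    μ (p ℕ.* e)                                              ≡⟨ μ-squareFree (0<prime* p-prime 0<e) sf′ ⟩
    (ℤ.- 1ℤ) ℤ.^ length (primeDivisors (p ℕ.* e))
      ≡⟨ cong ((ℤ.- 1ℤ) ℤ.^_) (↭-length (primeDivisors-prime* p-prime 0<e p∤e)) ⟩
    ℤ.- 1ℤ ℤ.* (ℤ.- 1ℤ) ℤ.^ length (primeDivisors e)         ≡⟨ ℤ.-1*i≡-i _ ⟩
    ℤ.- (ℤ.- 1ℤ) ℤ.^ length (primeDivisors e)                ≡⟨ cong ℤ.-_ (μ-squareFree 0<e sf) ⟨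
    ℤ.- μ e                                                  ∎
    where
    open ≡-Reasoning
    sf′ : SquareFree (p ℕ.* e)
    sf′ = All.tabulate λ q∈ q²∣pe →
      let q-prime = proj₁ (∈-primeDivisors⁻ (p ℕ.* e) q∈)
          q²∣e = square∣prime* p-prime q-prime p∤e q²∣pe
      in All.lookup sf (∈-primeDivisors⁺ 0<e q-prime (∣-trans (m∣m*n _) q²∣e)) q²∣e
  ... | no ¬sf = trans (μ-¬squareFree ¬sf′) (sym (cong ℤ.-_ (μ-¬squareFree ¬sf)))
    where
    ¬sf′ : ¬ SquareFree (p ℕ.* e)
    ¬sf′ sf = ¬sf (All.tabulate λ q∈ q²∣e →
      let q-prime , q∣e = ∈-primeDivisors⁻ e q∈
      in All.lookup sf (∈-primeDivisors⁺ (0<prime* p-prime 0<e) q-prime (∣n⇒∣m*n p q∣e)) (∣n⇒∣m*n p q²∣e))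

  μ-prime*-multiple : Prime p → 0 < e → p ∣ e → μ (p ℕ.* e) ≡ 0ℤ
  μ-prime*-multiple {p} {e} p-prime 0<e p∣e = μ-¬squareFree λ sf →
    All.lookup sf (∈-primeDivisors⁺ (0<prime* p-prime 0<e) p-prime (m∣m*n e)) (*-monoʳ-∣ p p∣e)

  prime-divisor : 2 ≤ n → ∃ λ p → Prime p × p ∣ n
  prime-divisor {n} 2≤n with factorise n {{>-nonZero (ℕ.<⇒≤ 2≤n)}}
  ... | record { factors = [] ; isFactorisation = ≡.refl } = contradiction 2≤n λ { (s≤s ()) }
  ... | record { factors = p ∷ ps ; isFactorisation = n≡ ; factorsPrime = p-prime ∷ _ } =
    p , p-prime , subst (p ∣_) (sym n≡) (m∣m*n (product ps))

  ∣prime*⇒∣ : Prime p → ¬ p ∣ d → d ∣ p ℕ.* n → d ∣ n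
  ∣prime*⇒∣ {p} {d} {n} p-prime p∤d (divides q pn≡qd) with euclidsLemma q d p-prime (subst (p ∣_) pn≡qd (m∣m*n n))
  ... | inj₂ p∣d = contradiction p∣d p∤d
  ... | inj₁ (divides-refl r) = divides r (ℕ.*-cancelˡ-≡ n (r ℕ.* d) p {{prime⇒nonZero p-prime}} (begin
    p ℕ.* n           ≡⟨ pn≡qd ⟩
    r ℕ.* p ℕ.* d     ≡⟨ cong (ℕ._* d) (ℕ.*-comm r p) ⟩
    p ℕ.* r ℕ.* d     ≡⟨ ℕ.*-assoc p r d ⟩
    p ℕ.* (r ℕ.* d)   ∎))
    where open ≡-Reasoning

  -- With n = p n′, the divisors p e (e ∣ n′) cancel against the divisors e prime to p.
  Σ-μ≡0 : 2 ≤ n → Σ[ divisors n ] μ ≡ 0ℤ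
  Σ-μ≡0 {n} 2≤n with p , p-prime , divides n′ n≡ ← prime-divisor 2≤n
    with ≡.refl ← trans n≡ (ℕ.*-comm n′ p) = begin
    Σ[ divisors (p ℕ.* n′) ] μ
      ≡⟨ Σ-partition (p ∣?_) (divisors (p ℕ.* n′)) μ ⟩
    Σ[ filter (p ∣?_) (divisors (p ℕ.* n′)) ] μ ℤ.+ Σ[ filter (¬? ∘ (p ∣?_)) (divisors (p ℕ.* n′)) ] μ
      ≡⟨ cong₂ ℤ._+_ (trans (Σ-↭ μ multiples) (Σ-map (p ℕ.*_) (divisors n′) μ)) (Σ-↭ μ coprimes) ⟩
    Σ[ divisors n′ ] (μ ∘ (p ℕ.*_)) ℤ.+ Σ[ E ] μ
      ≡⟨ cong (ℤ._+ Σ[ E ] μ) (trans (Σ-partition (p ∣?_) (divisors n′) (μ ∘ (p ℕ.*_)))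
           (trans (cong (ℤ._+ Σ[ E ] (μ ∘ (p ℕ.*_))) vanish) (ℤ.+-identityˡ (Σ[ E ] (μ ∘ (p ℕ.*_)))))) ⟩
    Σ[ E ] (μ ∘ (p ℕ.*_)) ℤ.+ Σ[ E ] μ
      ≡⟨ Σ-+ E (μ ∘ (p ℕ.*_)) μ ⟨
    Σ[ E ] (λ e → μ (p ℕ.* e) ℤ.+ μ e)
      ≡⟨ Σ-cong E cancel ⟩
    Σ[ E ] (λ _ → 0ℤ)
      ≡⟨ Σ-zero E ⟩
    0ℤ ∎
    where
    open ≡-Reasoning
    E : List ℕ
    E = filter (¬? ∘ (p ∣?_)) (divisors n′)
    instance
      p≢0 : NonZero p
      p≢0 = prime⇒nonZero p-prime
    0<pn′ : 0 < p ℕ.* n′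
    0<pn′ = ℕ.<⇒≤ 2≤n
    0<n′ : 0 < n′
    0<n′ = ∣⇒0< 0<pn′ (n∣m*n p)
    -- For e divisible by p, p e is divisible by p², so only the e prime to p survive among the
    -- divisors p e.
    vanish : Σ[ filter (p ∣?_) (divisors n′) ] (μ ∘ (p ℕ.*_)) ≡ 0ℤ
    vanish = trans (Σ-cong (filter (p ∣?_) (divisors n′)) λ e∈ →
      let e∈′ , p∣e = ∈-filter⁻ (p ∣?_) {xs = divisors n′} e∈
      in μ-prime*-multiple p-prime (proj₁ (∈-divisors⁻ n′ e∈′)) p∣e) (Σ-zero (filter (p ∣?_) (divisors n′)))
    cancel : ∀ {e} → e ∈ E → μ (p ℕ.* e) ℤ.+ μ e ≡ 0ℤ
    cancel {e} e∈ with e∈′ , p∤e ← ∈-filter⁻ (¬? ∘ (p ∣?_)) {xs = divisors n′} e∈ =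
      trans (cong (ℤ._+ μ e) (μ-prime*-coprime p-prime (proj₁ (∈-divisors⁻ n′ e∈′)) p∤e)) (ℤ.+-inverseˡ (μ e))
    multiples : filter (p ∣?_) (divisors (p ℕ.* n′)) ↭ map (p ℕ.*_) (divisors n′)
    multiples = unique∧set⇒↭ (Unique.filter⁺ (p ∣?_) (divisors-unique (p ℕ.* n′)))
      (Unique.map⁺ (ℕ.*-cancelˡ-≡ _ _ p) (divisors-unique n′)) to (λ d∈ → from (∈-map⁻ (p ℕ.*_) d∈))
      where
      to : ∀ {d} → d ∈ filter (p ∣?_) (divisors (p ℕ.* n′)) → d ∈ map (p ℕ.*_) (divisors n′)
      to d∈ with d∈′ , divides e d≡ ← ∈-filter⁻ (p ∣?_) {xs = divisors (p ℕ.* n′)} d∈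
        with ≡.refl ← trans d≡ (ℕ.*-comm e p) =
        ∈-map⁺ (p ℕ.*_) (∈-divisors⁺ 0<n′ (*-cancelˡ-∣ p (proj₂ (∈-divisors⁻ (p ℕ.* n′) d∈′))))
      from : ∀ {d} → (∃ λ e → e ∈ divisors n′ × d ≡ p ℕ.* e) → d ∈ filter (p ∣?_) (divisors (p ℕ.* n′))
      from (e , e∈ , ≡.refl) = ∈-filter⁺ (p ∣?_)
        (∈-divisors⁺ 0<pn′ (*-monoʳ-∣ p (proj₂ (∈-divisors⁻ n′ e∈)))) (m∣m*n e)
    coprimes : filter (¬? ∘ (p ∣?_)) (divisors (p ℕ.* n′)) ↭ E
    coprimes = unique∧set⇒↭ (Unique.filter⁺ (¬? ∘ (p ∣?_)) (divisors-unique (p ℕ.* n′)))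
      (Unique.filter⁺ (¬? ∘ (p ∣?_)) (divisors-unique n′)) to from
      where
      to : ∀ {d} → d ∈ filter (¬? ∘ (p ∣?_)) (divisors (p ℕ.* n′)) → d ∈ E
      to d∈ with d∈′ , p∤d ← ∈-filter⁻ (¬? ∘ (p ∣?_)) {xs = divisors (p ℕ.* n′)} d∈ = ∈-filter⁺ (¬? ∘ (p ∣?_))
        (∈-divisors⁺ 0<n′ (∣prime*⇒∣ p-prime p∤d (proj₂ (∈-divisors⁻ (p ℕ.* n′) d∈′)))) p∤d
      from : ∀ {d} → d ∈ E → d ∈ filter (¬? ∘ (p ∣?_)) (divisors (p ℕ.* n′))
      from d∈ with d∈′ , p∤d ← ∈-filter⁻ (¬? ∘ (p ∣?_)) {xs = divisors n′} d∈ = ∈-filter⁺ (¬? ∘ (p ∣?_))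
        (∈-divisors⁺ 0<pn′ (∣n⇒∣m*n p (proj₂ (∈-divisors⁻ n′ d∈′)))) p∤d

  0<div : 0 < N → d ∣ N → 0 < N div d
  0<div {N} {d} 0<N d∣N = ℕ.n≢0⇒n>0 λ N/d≡0 → ℕ.<⇒≢ 0<N
    (trans (sym (trans (cong (d ℕ.*_) N/d≡0) (ℕ.*-zeroʳ d))) (*-div (∣⇒0< 0<N d∣N) d∣N))

  div∣ : 0 < N → d ∣ N → N div d ∣ N
  div∣ {N} {d} 0<N d∣N = divides d (sym (*-div (∣⇒0< 0<N d∣N) d∣N))

  div-div : 0 < N → d ∣ N → N div (N div d) ≡ d
  div-div {N} {d} 0<N d∣N = div-unique (0<div 0<N d∣N)
    (trans (ℕ.*-comm (N div d) d) (*-div (∣⇒0< 0<N d∣N) d∣N))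

  -- The involution d ↦ N / d on the divisors of N takes the multiples of e to the divisors of N /
  -- e.
  div-codivisors : 0 < N → e ∣ N → filter (e ∣?_) (divisors N) ↭ map (N div_) (divisors (N div e))
  div-codivisors {N} {e} 0<N e∣N = unique∧set⇒↭ (Unique.filter⁺ (e ∣?_) (divisors-unique N))
    (map⁺-unique (N div_) inj (divisors-unique (N div e))) to (λ d∈ → from (∈-map⁻ (N div_) d∈))
    where
    open ≡-Reasoning
    0<e : 0 < e
    0<e = ∣⇒0< 0<N e∣N
    ∣N : ∀ {t} → t ∈ divisors (N div e) → t ∣ N
    ∣N t∈ = ∣-trans (proj₂ (∈-divisors⁻ (N div e) t∈)) (div∣ 0<N e∣N)
    inj : ∀ {s t} → s ∈ divisors (N div e) → t ∈ divisors (N div e) → N div s ≡ N div t → s ≡ t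
    inj s∈ t∈ eq = trans (sym (div-div 0<N (∣N s∈))) (trans (cong (N div_) eq) (div-div 0<N (∣N t∈)))
    to : ∀ {d} → d ∈ filter (e ∣?_) (divisors N) → d ∈ map (N div_) (divisors (N div e))
    to d∈ with d∈′ , divides-refl s ← ∈-filter⁻ (e ∣?_) {xs = divisors N} d∈
      with 0<d , d∣N ← ∈-divisors⁻ N d∈′ = subst (_∈ map (N div_) (divisors (N div e))) (div-div 0<N d∣N)
        (∈-map⁺ (N div_) (∈-divisors⁺ (0<div 0<N e∣N) (divides s (div-unique 0<e (begin
          e ℕ.* (s ℕ.* (N div (s ℕ.* e))) ≡⟨ ℕ.*-assoc e s _ ⟨
          e ℕ.* s ℕ.* (N div (s ℕ.* e))   ≡⟨ cong (ℕ._* (N div (s ℕ.* e))) (ℕ.*-comm e s) ⟩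
          s ℕ.* e ℕ.* (N div (s ℕ.* e))   ≡⟨ *-div 0<d d∣N ⟩
          N                               ∎)))))
    from : ∀ {d} → (∃ λ t → t ∈ divisors (N div e) × d ≡ N div t) → d ∈ filter (e ∣?_) (divisors N)
    from (t , t∈ , ≡.refl) with 0<t , divides s N/e≡st ← ∈-divisors⁻ (N div e) t∈ =
      ∈-filter⁺ (e ∣?_) (∈-divisors⁺ 0<N (div∣ 0<N (∣N t∈))) (divides s (div-unique 0<t (begin
        t ℕ.* (s ℕ.* e) ≡⟨ ℕ.*-assoc t s e ⟨
        t ℕ.* s ℕ.* e   ≡⟨ cong (ℕ._* e) (ℕ.*-comm t s) ⟩
        s ℕ.* t ℕ.* e   ≡⟨ cong (ℕ._* e) N/e≡st ⟨
        (N div e) ℕ.* e ≡⟨ ℕ.*-comm (N div e) e ⟩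
        e ℕ.* (N div e) ≡⟨ *-div 0<e e∣N ⟩
        N               ∎)))

  -- Makes the range of the inner sum independent of d, so that a double sum over divisors can be
  -- interchanged.
  divisors-filter : 0 < N → d ∣ N → divisors d ↭ filter (_∣? d) (divisors N)
  divisors-filter {N} {d} 0<N d∣N = unique∧set⇒↭ (divisors-unique d) (Unique.filter⁺ (_∣? d) (divisors-unique N))
    (λ e∈ → let e∣d = proj₂ (∈-divisors⁻ d e∈) in ∈-filter⁺ (_∣? d) (∈-divisors⁺ 0<N (∣-trans e∣d d∣N)) e∣d)
    (λ e∈ → ∈-divisors⁺ (∣⇒0< 0<N d∣N) (proj₂ (∈-filter⁻ (_∣? d) {xs = divisors N} e∈)))

  N-div-N : 0 < N → N div N ≡ 1
  N-div-N {N} 0<N = div-unique 0<N (ℕ.*-identityʳ N)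

  -- After the interchange, h(e) is multiplied by the sum of μ(N/d) over e ∣ d ∣ N, which is the sum
  -- of μ over the divisors of N/e: 1 for e = N and 0 otherwise.
  möbius-inversion : ∀ (h : ℕ → ℤ) → 0 < N →
                     Σ[ divisors N ] (λ d → μ (N div d) ℤ.* Σ[ divisors d ] h) ≡ h N
  möbius-inversion {N} h 0<N = begin
    Σ[ D ] (λ d → μ (N div d) ℤ.* Σ[ divisors d ] h)
      ≡⟨ Σ-cong D (λ {d} d∈ → trans
           (cong (μ (N div d) ℤ.*_) (trans (Σ-↭ h (divisors-filter 0<N (proj₂ (∈-divisors⁻ N d∈))))
             (Σ-filter (_∣? d) D h)))
           (sym (Σ-*ˡ D (μ (N div d)) (λ e → ⟦ e ∣? d ⟧ ℤ.* h e)))) ⟩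
    Σ[ D ] (λ d → Σ[ D ] (λ e → μ (N div d) ℤ.* (⟦ e ∣? d ⟧ ℤ.* h e)))
      ≡⟨ Σ-swap D D (λ d e → μ (N div d) ℤ.* (⟦ e ∣? d ⟧ ℤ.* h e)) ⟩
    Σ[ D ] (λ e → Σ[ D ] (λ d → μ (N div d) ℤ.* (⟦ e ∣? d ⟧ ℤ.* h e)))
      ≡⟨ Σ-cong D (λ {e} e∈ → trans
           (Σ-cong D (λ {d} _ → rearrange (μ (N div d)) ⟦ e ∣? d ⟧ (h e)))
           (Σ-*ˡ D (h e) (λ d → ⟦ e ∣? d ⟧ ℤ.* μ (N div d)))) ⟩
    Σ[ D ] (λ e → h e ℤ.* Σ[ D ] (λ d → ⟦ e ∣? d ⟧ ℤ.* μ (N div d)))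
      ≡⟨ Σ-cong D (λ {e} e∈ → cong (h e ℤ.*_) (inner (proj₂ (∈-divisors⁻ N e∈)))) ⟩
    Σ[ D ] (λ e → h e ℤ.* Σ[ divisors (N div e) ] μ)
      ≡⟨ Σ-↭ (λ e → h e ℤ.* Σ[ divisors (N div e) ] μ) (divisors-↭ 0<N) ⟩
    h N ℤ.* Σ[ divisors (N div N) ] μ ℤ.+ Σ[ properDivisors N ] (λ e → h e ℤ.* Σ[ divisors (N div e) ] μ)
      -- The sum of μ over `divisors 1` computes to 1.
      ≡⟨ cong₂ ℤ._+_ (trans (cong (λ n → h N ℤ.* Σ[ divisors n ] μ) (N-div-N 0<N)) (ℤ.*-identityʳ (h N)))
           (trans (Σ-cong (properDivisors N) vanish) (Σ-zero (properDivisors N))) ⟩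
    h N ℤ.+ 0ℤ
      ≡⟨ ℤ.+-identityʳ (h N) ⟩
    h N ∎
    where
    open ≡-Reasoning
    D : List ℕ
    D = divisors N
    rearrange : ∀ a b c → a ℤ.* (b ℤ.* c) ≡ c ℤ.* (b ℤ.* a)
    rearrange a b c = trans (ℤ.*-comm a (b ℤ.* c)) (trans (cong (ℤ._* a) (ℤ.*-comm b c)) (ℤ.*-assoc c b a))
    inner : ∀ {e} → e ∣ N → Σ[ D ] (λ d → ⟦ e ∣? d ⟧ ℤ.* μ (N div d)) ≡ Σ[ divisors (N div e) ] μ
    inner {e} e∣N = begin
      Σ[ D ] (λ d → ⟦ e ∣? d ⟧ ℤ.* μ (N div d))              ≡⟨ Σ-filter (e ∣?_) D (λ d → μ (N div d)) ⟨
      Σ[ filter (e ∣?_) D ] (λ d → μ (N div d))              ≡⟨ Σ-↭ (λ d → μ (N div d)) (div-codivisors 0<N e∣N) ⟩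
      Σ[ map (N div_) (divisors (N div e)) ] (λ d → μ (N div d))
      ≡⟨ Σ-map (N div_) (divisors (N div e)) (λ d → μ (N div d)) ⟩
      Σ[ divisors (N div e) ] (λ t → μ (N div (N div t)))
        ≡⟨ Σ-cong (divisors (N div e)) (λ t∈ → cong μ (div-div 0<N
             (∣-trans (proj₂ (∈-divisors⁻ (N div e) t∈)) (div∣ 0<N e∣N)))) ⟩
      Σ[ divisors (N div e) ] μ                              ∎
    vanish : ∀ {e} → e ∈ properDivisors N → h e ℤ.* Σ[ divisors (N div e) ] μ ≡ 0ℤ
    vanish {e} e∈ with 0<e , e<N , e∣N ← ∈-properDivisors⁻ N e∈ =
      trans (cong (h e ℤ.*_) (Σ-μ≡0 (2≤div 0<e e<N e∣N))) (ℤ.*-zeroʳ (h e))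

open Möbius

-- The formulas over ℤ, their division by factorials, and the theorem

open import Data.Nat using (ℕ; _≤_; _∸_)
open import Data.Integer using (ℤ; +_; _+_; _*_; _-_; -_)
open import Data.Rational using (ℚ)
import Data.Rational as ℚ
open import Data.Product using (_×_)
open import Relation.Binary.PropositionalEquality using (_≡_)

import Algebra.Properties.Group as Group
import Data.Integer.Properties as ℤ
open import Data.Integer.Tactic.RingSolver using (solve-∀)
open import Data.Nat using (suc; NonZero; _!)
import Data.Rational.Properties as ℚ
open import Data.Rational.Unnormalised as ℚᵘ using (mkℚᵘ; *≡*)
import Data.Rational.Unnormalised.Properties as ℚᵘ
open import Relation.Binary.PropositionalEquality as ≡ using (cong; cong₂; sym; trans; module ≡-Reasoning)

module Σℕ = Summation ℕ.+-*-commutativeSemiring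
module Σℤ = Summation ℤ.+-*-commutativeSemiring
module Σℚ = Summation (CommutativeRing.commutativeSemiring ℚ.+-*-commutativeRing)

pos-Σ : ∀ (xs : List ℕ) f → + (Σℕ.Σ[ xs ] f) ≡ Σℤ.Σ[ xs ] (λ x → + f x)
pos-Σ [] f = ≡.refl
pos-Σ (x ∷ xs) f = cong (λ s → + f x + s) (pos-Σ xs f)

recurrenceℤ : ∀ k N → 0 ℕ.< N →
              + 𝒩 (suc k) N ≡ Σℤ[d∣ N ,d<] (λ d → + k * + 𝒩 (suc k) d + + suc k * + 𝒩 k d)
recurrenceℤ k N 0<N = begin
  + 𝒩 (suc k) N
    ≡⟨ cong +_ (recurrence k N 0<N) ⟩
  + (Σℕ.Σ[ properDivisors N ] (λ d → k ℕ.* 𝒩 (suc k) d ℕ.+ suc k ℕ.* 𝒩 k d))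
    ≡⟨ pos-Σ (properDivisors N) _ ⟩
  Σℤ[d∣ N ,d<] (λ d → + (k ℕ.* 𝒩 (suc k) d) + + (suc k ℕ.* 𝒩 k d))
    ≡⟨ Σℤ.Σ-cong (properDivisors N) (λ {d} _ → cong₂ _+_ (ℤ.pos-* k (𝒩 (suc k) d)) (ℤ.pos-* (suc k) (𝒩 k d))) ⟩
  Σℤ[d∣ N ,d<] (λ d → + k * + 𝒩 (suc k) d + + suc k * + 𝒩 k d) ∎
  where open ≡-Reasoning

-- Möbius inversion of Σ_{d∣N} (k 𝒩_{k+1}(d) + (k+1) 𝒩_k(d)) = (k+1) (𝒩_{k+1}(N) + 𝒩_k(N)).
möbius-recurrence : ∀ k N → 0 ℕ.< N →
                    + 𝒩 (suc k) N ≡ - (+ suc k) * Σℤ[d∣ N ,d<] (λ d → μ (N div d) * (+ 𝒩 (suc k) d + + 𝒩 k d))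
möbius-recurrence k N 0<N = begin
  F N                                          ≡⟨ isolate (+ k) (F N) (G N) (Σℤ[d∣ N ,d<] s) inverted ⟩
  - (+ suc k * Σℤ[d∣ N ,d<] s)                 ≡⟨ ℤ.neg-distribˡ-* (+ suc k) (Σℤ[d∣ N ,d<] s) ⟩
  - (+ suc k) * Σℤ[d∣ N ,d<] s                 ∎
  where
  open ≡-Reasoning
  F G h s : ℕ → ℤ
  F d = + 𝒩 (suc k) d
  G d = + 𝒩 k d
  h d = + k * F d + + suc k * G d
  s d = μ (N div d) * (F d + G d)
  -- `+ suc k` computes from `+ 1 + + k`, so `+ 1 + a` lets the ring solver treat it as a polynomial
  -- in a.
  collect : ∀ a x y → a * x + (+ 1 + a) * y + x ≡ (+ 1 + a) * (x + y)
  collect = solve-∀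
  Σ-h : ∀ {d} → 0 ℕ.< d → Σℤ.Σ[ divisors d ] h ≡ + suc k * (F d + G d)
  Σ-h {d} 0<d = begin
    Σℤ.Σ[ divisors d ] h       ≡⟨ Σℤ.Σ-↭ h (divisors-↭ 0<d) ⟩
    h d + Σℤ[d∣ d ,d<] h       ≡⟨ cong (λ s → h d + s) (recurrenceℤ k d 0<d) ⟨
    h d + F d                  ≡⟨ collect (+ k) (F d) (G d) ⟩
    + suc k * (F d + G d)      ∎
  swapˡ : ∀ a b c → a * (b * c) ≡ b * (a * c)
  swapˡ = solve-∀
  inverted : + k * F N + + suc k * G N ≡ + suc k * (F N + G N + Σℤ[d∣ N ,d<] s)
  inverted = begin
    h N
      ≡⟨ möbius-inversion h 0<N ⟨
    Σℤ.Σ[ divisors N ] (λ d → μ (N div d) * Σℤ.Σ[ divisors d ] h)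
      ≡⟨ Σℤ.Σ-cong (divisors N) (λ {d} d∈ → trans
           (cong (μ (N div d) *_) (Σ-h (proj₁ (∈-divisors⁻ N d∈))))
           (swapˡ (μ (N div d)) (+ suc k) (F d + G d))) ⟩
    Σℤ.Σ[ divisors N ] (λ d → + suc k * s d)
      ≡⟨ Σℤ.Σ-*ˡ (divisors N) (+ suc k) s ⟩
    + suc k * Σℤ.Σ[ divisors N ] s
      ≡⟨ cong ((+ suc k) *_) (Σℤ.Σ-↭ s (divisors-↭ 0<N)) ⟩
    + suc k * (s N + Σℤ[d∣ N ,d<] s)
      ≡⟨ cong (λ x → + suc k * (x + Σℤ[d∣ N ,d<] s))
           (trans (cong (λ n → μ n * (F N + G N)) (N-div-N 0<N)) (ℤ.*-identityˡ (F N + G N))) ⟩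
    + suc k * (F N + G N + Σℤ[d∣ N ,d<] s) ∎
  regroup : ∀ a x y z → (+ 1 + a) * (x + y + z) + - (a * x + (+ 1 + a) * y) + - ((+ 1 + a) * z) ≡ x
  regroup = solve-∀
  cancel : ∀ a b → a + - a + - b ≡ - b
  cancel = solve-∀
  -- The solver proves identities only: `regroup` writes x as right side minus left side of the
  -- hypothesis, minus (1+a) z, and the hypothesis then cancels the difference.
  isolate : ∀ a x y z → a * x + (+ 1 + a) * y ≡ (+ 1 + a) * (x + y + z) → x ≡ - ((+ 1 + a) * z)
  isolate a x y z eq = begin
    x ≡⟨ regroup a x y z ⟨
    (+ 1 + a) * (x + y + z) + - (a * x + (+ 1 + a) * y) + - ((+ 1 + a) * z)
      ≡⟨ cong (λ u → (+ 1 + a) * (x + y + z) + - u + - ((+ 1 + a) * z)) eq ⟩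
    (+ 1 + a) * (x + y + z) + - ((+ 1 + a) * (x + y + z)) + - ((+ 1 + a) * z)
      ≡⟨ cancel ((+ 1 + a) * (x + y + z)) ((+ 1 + a) * z) ⟩
    - ((+ 1 + a) * z) ∎

toℚᵘ-/ : ∀ a d → ℚ.toℚᵘ (a ℚ./ suc d) ℚᵘ.≃ mkℚᵘ a d
toℚᵘ-/ a d = ℚ.toℚᵘ-fromℚᵘ (mkℚᵘ a d)

ι : ℤ → ℚ
ι a = a ℚ./ 1

ι-+ : ∀ a b → ι (a + b) ≡ ι a ℚ.+ ι b
ι-+ a b = ℚ.toℚᵘ-injective (begin
  ℚ.toℚᵘ (ι (a + b))                   ≈⟨ toℚᵘ-/ (a + b) 0 ⟩
  mkℚᵘ (a + b) 0                       ≡⟨ cong₂ (λ x y → mkℚᵘ (x + y) 0) (ℤ.*-identityʳ a) (ℤ.*-identityʳ b) ⟨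
  mkℚᵘ a 0 ℚᵘ.+ mkℚᵘ b 0               ≈⟨ ℚᵘ.+-cong (toℚᵘ-/ a 0) (toℚᵘ-/ b 0) ⟨
  ℚ.toℚᵘ (ι a) ℚᵘ.+ ℚ.toℚᵘ (ι b)       ≈⟨ ℚ.toℚᵘ-homo-+ (ι a) (ι b) ⟨
  ℚ.toℚᵘ (ι a ℚ.+ ι b)                 ∎)
  where open ℚᵘ.≃-Reasoning

-- Cross-multiplication, done on unnormalised fractions where no common divisor has been cancelled.
ι-*-/ : ∀ a b c d e .{{_ : NonZero d}} .{{_ : NonZero e}} →
        a * + e ≡ b * c * + d → a ℚ./ d ≡ ι b ℚ.* (c ℚ./ e)
ι-*-/ a b c (suc d) (suc e) eq = ℚ.toℚᵘ-injective (begin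
  ℚ.toℚᵘ (a ℚ./ suc d)                       ≈⟨ toℚᵘ-/ a d ⟩
  mkℚᵘ a d                                   ≈⟨ *≡* (trans (cong (λ e → a * + suc e) (ℕ.+-identityʳ e)) eq) ⟩
  mkℚᵘ b 0 ℚᵘ.* mkℚᵘ c e                     ≈⟨ ℚᵘ.*-cong (toℚᵘ-/ b 0) (toℚᵘ-/ c e) ⟨
  ℚ.toℚᵘ (ι b) ℚᵘ.* ℚ.toℚᵘ (c ℚ./ suc e)     ≈⟨ ℚ.toℚᵘ-homo-* (ι b) (c ℚ./ suc e) ⟨
  ℚ.toℚᵘ (ι b ℚ.* (c ℚ./ suc e))             ∎)
  where open ℚᵘ.≃-Reasoning

ι-* : ∀ a b → ι (a * b) ≡ ι a ℚ.* ι b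
ι-* a b = ι-*-/ (a * b) a b 1 1 ≡.refl

ι-neg : ∀ a → ι (- a) ≡ ℚ.- ι a
ι-neg a = Group.inverseˡ-unique ℚ.+-0-group (ι (- a)) (ι a)
  (trans (sym (ι-+ (- a) a)) (cong ι (ℤ.+-inverseˡ a)))

ι-Σ : ∀ (xs : List ℕ) f → ι (Σℤ.Σ[ xs ] f) ≡ Σℚ.Σ[ xs ] (λ x → ι (f x))
ι-Σ [] f = ≡.refl
ι-Σ (x ∷ xs) f = trans (ι-+ (f x) (Σℤ.Σ[ xs ] f)) (cong (ι (f x) ℚ.+_) (ι-Σ xs f))

-- Turns ℳ into an embedded integer times a rational constant, so that the formulas for 𝒩 can be
-- multiplied through.
1/_! : ℕ → ℚ
1/ k ! = ℚ._/_ (+ 1) (k !) {{k ℕ.!≢0}}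

ℳ≡𝒩*1/! : ∀ k n → ℳ k n ≡ ι (+ 𝒩 k n) ℚ.* 1/ k !
ℳ≡𝒩*1/! k n = ι-*-/ (+ 𝒩 k n) (+ 𝒩 k n) (+ 1) (k !) (k !) {{k ℕ.!≢0}} {{k ℕ.!≢0}}
  (cong (_* + (k !)) (sym (ℤ.*-identityʳ (+ 𝒩 k n))))

1/!-suc : ∀ k → 1/ k ! ≡ ι (+ suc k) ℚ.* 1/ suc k !
1/!-suc k = ι-*-/ (+ 1) (+ suc k) (+ 1) (k !) (suc k !) {{k ℕ.!≢0}} {{suc k ℕ.!≢0}} (begin
  + 1 * + (suc k !)       ≡⟨ ℤ.*-identityˡ (+ (suc k !)) ⟩
  + (suc k ℕ.* k !)       ≡⟨ ℤ.pos-* (suc k) (k !) ⟩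
  + suc k * + (k !)       ≡⟨ cong (_* + (k !)) (ℤ.*-identityʳ (+ suc k)) ⟨
  + suc k * + 1 * + (k !) ∎)
  where open ≡-Reasoning

Σ-*ʳ : ∀ (xs : List ℕ) (f : ℕ → ℚ) c → Σℚ.Σ[ xs ] f ℚ.* c ≡ Σℚ.Σ[ xs ] (λ x → f x ℚ.* c)
Σ-*ʳ xs f c = trans (ℚ.*-comm (Σℚ.Σ[ xs ] f) c) (trans (sym (Σℚ.Σ-*ˡ xs c f))
  (Σℚ.Σ-cong xs (λ {x} _ → ℚ.*-comm c (f x))))

-- (k+1)/(k+1)! = 1/k! absorbs the coefficient of 𝒩 k. The coefficient a is k in the first formula
-- and k+1 in the second.
combine : ∀ k d a → ι (a * + 𝒩 (suc k) d + + suc k * + 𝒩 k d) ℚ.* 1/ suc k ! ≡ ι a ℚ.* ℳ (suc k) d ℚ.+ ℳ k d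
combine k d a = begin
  ι (a * F + m * G) ℚ.* r
    ≡⟨ cong (ℚ._* r) (trans (ι-+ (a * F) (m * G)) (cong₂ ℚ._+_ (ι-* a F) (ι-* m G))) ⟩
  (ι a ℚ.* ι F ℚ.+ ι m ℚ.* ι G) ℚ.* r
    ≡⟨ ℚ.*-distribʳ-+ r (ι a ℚ.* ι F) (ι m ℚ.* ι G) ⟩
  ι a ℚ.* ι F ℚ.* r ℚ.+ ι m ℚ.* ι G ℚ.* r
    ≡⟨ cong₂ ℚ._+_ (ℚ.*-assoc (ι a) (ι F) r)
         (trans (cong (ℚ._* r) (ℚ.*-comm (ι m) (ι G))) (ℚ.*-assoc (ι G) (ι m) r)) ⟩
  ι a ℚ.* (ι F ℚ.* r) ℚ.+ ι G ℚ.* (ι m ℚ.* r)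
    ≡⟨ cong₂ ℚ._+_ (cong (ι a ℚ.*_) (ℳ≡𝒩*1/! (suc k) d))
         (trans (ℳ≡𝒩*1/! k d) (cong (ι G ℚ.*_) (1/!-suc k))) ⟨
  ι a ℚ.* ℳ (suc k) d ℚ.+ ℳ k d ∎
  where
  open ≡-Reasoning
  F G m : ℤ
  F = + 𝒩 (suc k) d
  G = + 𝒩 k d
  m = + suc k
  r : ℚ
  r = 1/ suc k !

ℳ-recurrence : ∀ k N → 0 ℕ.< N →
               ℳ (suc k) N ≡ Σℚ[d∣ N ,d<] (λ d → (ι (+ suc k) ℚ.- ℚ.1ℚ) ℚ.* ℳ (suc k) d ℚ.+ ℳ k d)
ℳ-recurrence k N 0<N = begin
  ℳ (suc k) N                           ≡⟨ ℳ≡𝒩*1/! (suc k) N ⟩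
  ι (+ 𝒩 (suc k) N) ℚ.* r              ≡⟨ cong (λ x → ι x ℚ.* r) (recurrenceℤ k N 0<N) ⟩
  ι (Σℤ[d∣ N ,d<] h) ℚ.* r              ≡⟨ cong (ℚ._* r) (ι-Σ (properDivisors N) h) ⟩
  Σℚ[d∣ N ,d<] (λ d → ι (h d)) ℚ.* r    ≡⟨ Σ-*ʳ (properDivisors N) (λ d → ι (h d)) r ⟩
  Σℚ[d∣ N ,d<] (λ d → ι (h d) ℚ.* r)
    ≡⟨ Σℚ.Σ-cong (properDivisors N) (λ {d} _ → trans (combine k d (+ k))
         -- The coefficient `+ k` is what `+ suc k + - + 1` computes to, which gives the shape m - 1
         -- of the statement.
         (cong (λ x → x ℚ.* ℳ (suc k) d ℚ.+ ℳ k d) (trans (ι-+ (+ suc k) (- + 1))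
           (cong (ι (+ suc k) ℚ.+_) (ι-neg (+ 1)))))) ⟩
  Σℚ[d∣ N ,d<] (λ d → (ι (+ suc k) ℚ.- ℚ.1ℚ) ℚ.* ℳ (suc k) d ℚ.+ ℳ k d) ∎
  where
  open ≡-Reasoning
  h : ℕ → ℤ
  h d = + k * + 𝒩 (suc k) d + + suc k * + 𝒩 k d
  r : ℚ
  r = 1/ suc k !

ℳ-möbius-recurrence : ∀ k N → 0 ℕ.< N →
  ℳ (suc k) N ≡ ℚ.- Σℚ[d∣ N ,d<] (λ d → ι (μ (N div d)) ℚ.* (ι (+ suc k) ℚ.* ℳ (suc k) d ℚ.+ ℳ k d))
ℳ-möbius-recurrence k N 0<N = begin
  ℳ (suc k) N                           ≡⟨ ℳ≡𝒩*1/! (suc k) N ⟩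
  ι (+ 𝒩 (suc k) N) ℚ.* r              ≡⟨ cong (λ x → ι x ℚ.* r) (möbius-recurrence k N 0<N) ⟩
  ι (- m * Σℤ[d∣ N ,d<] s) ℚ.* r
    ≡⟨ cong (λ x → ι x ℚ.* r) (trans (sym (ℤ.neg-distribˡ-* m (Σℤ[d∣ N ,d<] s)))
         (cong -_ (sym (Σℤ.Σ-*ˡ (properDivisors N) m s)))) ⟩
  ι (- ms) ℚ.* r
    ≡⟨ trans (cong (ℚ._* r) (ι-neg ms)) (sym (ℚ.neg-distribˡ-* (ι ms) r)) ⟩
  ℚ.- (ι (ms) ℚ.* r)
    ≡⟨ cong ℚ.-_ (trans (cong (ℚ._* r) (ι-Σ (properDivisors N) (λ d → m * s d)))
         (trans (Σ-*ʳ (properDivisors N) (λ d → ι (m * s d)) r) (Σℚ.Σ-cong (properDivisors N) (λ {d} _ → term d)))) ⟩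
  ℚ.- Σℚ[d∣ N ,d<] (λ d → ι (μ (N div d)) ℚ.* (ι m ℚ.* ℳ (suc k) d ℚ.+ ℳ k d)) ∎
  where
  open ≡-Reasoning
  m : ℤ
  m = + suc k
  s : ℕ → ℤ
  s d = μ (N div d) * (+ 𝒩 (suc k) d + + 𝒩 k d)
  r : ℚ
  r = 1/ suc k !
  ms : ℤ
  ms = Σℤ[d∣ N ,d<] (λ d → m * s d)
  distribute : ∀ m u x y → m * (u * (x + y)) ≡ u * (m * x + m * y)
  distribute = solve-∀
  term : ∀ d → ι (m * s d) ℚ.* r ≡ ι (μ (N div d)) ℚ.* (ι m ℚ.* ℳ (suc k) d ℚ.+ ℳ k d)
  term d = begin
    ι (m * s d) ℚ.* r
      ≡⟨ cong (λ x → ι x ℚ.* r) (distribute m (μ (N div d)) (+ 𝒩 (suc k) d) (+ 𝒩 k d)) ⟩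
    ι (μ (N div d) * t) ℚ.* r                        ≡⟨ cong (ℚ._* r) (ι-* (μ (N div d)) t) ⟩
    ι (μ (N div d)) ℚ.* ι t ℚ.* r                    ≡⟨ ℚ.*-assoc (ι (μ (N div d))) (ι t) r ⟩
    ι (μ (N div d)) ℚ.* (ι t ℚ.* r)                  ≡⟨ cong (ι (μ (N div d)) ℚ.*_) (combine k d m) ⟩
    ι (μ (N div d)) ℚ.* (ι m ℚ.* ℳ (suc k) d ℚ.+ ℳ k d) ∎
    where
    t : ℤ
    t = m * + 𝒩 (suc k) d + m * + 𝒩 k d

theorem4p2 : (m N : ℕ) → 1 ≤ m → 2 ≤ N →
    ((+ 𝒩 m N) ≡ Σℤ[d∣ N ,d<] (λ d → (+ m - + 1) * (+ 𝒩 m d) + (+ m) * (+ 𝒩 (m ∸ 1) d)))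
    × ((+ 𝒩 m N) ≡ - (+ m) * Σℤ[d∣ N ,d<] (λ d → μ (N div d) * ((+ 𝒩 m d) + (+ 𝒩 (m ∸ 1) d))))
    × (ℳ m N ≡ Σℚ[d∣ N ,d<] (λ d → (ℚ._-_ (ℚ._/_ (+ m) 1) ℚ.1ℚ) ℚ.* ℳ m d ℚ.+ ℳ (m ∸ 1) d))
    × (ℳ m N ≡ ℚ.- Σℚ[d∣ N ,d<] (λ d → (ℚ._/_ (μ (N div d)) 1) ℚ.* ((ℚ._/_ (+ m) 1) ℚ.* ℳ m d ℚ.+ ℳ (m ∸ 1) d)))
-- With m = k+1, `+ m - + 1` and `m ∸ 1` compute to `+ k` and `k`, so the formulas in k apply
-- directly.
theorem4p2 (suc k) N _ 2≤N =
  recurrenceℤ k N 0<N , möbius-recurrence k N 0<N , ℳ-recurrence k N 0<N , ℳ-möbius-recurrence k N 0<N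
  where
  0<N : 0 ℕ.< N
  0<N = ℕ.<⇒≤ 2≤N
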